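{- Let $\mathcal{T}_\alpha=((\mathcal{V},\mathcal{E},\alpha),\mathcal{F})$ be a magnetic triangulation. The exterior magnetic derivative operator satisfies the following gauge invariance: for every real function $f:\mathcal{V}\to\mathbb{R}$ and every $\varphi\in\mathcal{C}_{skew}(\mathcal{E})$, $$d^1_{\alpha+d^0f}(e^{if}.\varphi)=e^{if}.\,d^1_\alpha(\varphi).$$
   Context: A magnetic triangulation consists of an at most countable vertex set $\mathcal{V}$, a symmetric edge set $\mathcal{E}\subset\mathcal{V}\times\mathcal{V}$ without loops (the graph is assumed connected and locally finite), a magnetic potential $\alpha:\mathcal{E}\to\mathbb{R}$ with $\alpha(x,y)=-\alpha(y,x)$, and a set of faces $\mathcal{F}\subset\mathcal{V}^3$, stable under all permutations of the entries, such that $(x,y,z)\in\mathcal{F}$ implies $x,y,z$ pairwise adjacent. $\mathcal{C}_{skew}(\mathcal{E})$ is the set of $\varphi:\mathcal{E}\to\mathbb{C}$ with $\varphi(x,y)=-\varphi(y,x)$; $\mathcal{C}_{skew}(\mathcal{F})$ is the set of functions $\mathcal{F}\to\mathbb{C}$ alternating under permutations of the entries. Let $d^0f(x,y)=f(y)-f(x)$. The exterior magnetic derivative $d^1_\alpha:\mathcal{C}_{skew}(\mathcal{E})\to\mathcal{C}_{skew}(\mathcal{F})$ is $$d^1_\alpha\varphi(x,y,z)=e^{\frac i6(\alpha(x,z)+\alpha(y,z))}\varphi(x,y)+e^{\frac i6(\alpha(y,x)+\alpha(z,x))}\varphi(y,z)+e^{\frac i6(\alpha(z,y)+\alpha(x,y))}\varphi(z,x).$$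 The change of gauge given by a real function $f$ on $\mathcal{V}$ acts on $\varphi\in\mathcal{C}_{skew}(\mathcal{E})$ by $(e^{if}.\varphi)(x,y)=e^{\frac i2(f(x)+f(y))}\varphi(x,y)$ and on $\psi\in\mathcal{C}_{skew}(\mathcal{F})$ by $(e^{if}.\psi)(x,y,z)=e^{\frac i3(f(x)+f(y)+f(z))}\psi(x,y,z)$. -}

module Defs where

open import Data.Integer.Base as ℤ using (+_; -[1+_])
import Data.Integer.Properties as ℤ
open import Data.List.Membership.Propositional using (_∈_)
open import Data.Nat.Base as ℕ using (ℕ; zero; suc; _!)
import Data.Nat.Properties as ℕ
open import Data.Product.Base using (∃-syntax; _×_; _,_; proj₁; proj₂)
open import Data.Rational.Base
open import Data.Rational.Properties
open import Data.Rational.Solver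
import Data.Rational.Unnormalised.Base as ℚᵘ
import Data.Rational.Unnormalised.Properties as ℚᵘ
open import Data.Sum.Base using (_⊎_; inj₁; inj₂)
open import Function.Bundles using (_↣_; _⇔_)
open import Relation.Binary.Construct.Closure.ReflexiveTransitive using (Star)
open import Relation.Binary.PropositionalEquality
  using (_≡_; refl; sym; trans; cong; cong₂; subst; module ≡-Reasoning)
open import Relation.Nullary using (¬_)
open +-*-Solver using (solve; _:=_; _:+_; _:*_; _:-_; :-_; con)

------------------------------------------------------------------------
-- Auxiliary facts about ℚ

*-monoˡ-≤ : ∀ {r p q} → 0ℚ ≤ r → p ≤ q → r * p ≤ r * q
*-monoˡ-≤ {r} 0≤r = *-monoˡ-≤-nonNeg r {{nonNegative 0≤r}}

*-monoʳ-≤ : ∀ {r p q} → 0ℚ ≤ r → p ≤ q → p * r ≤ q * r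
*-monoʳ-≤ {r} 0≤r = *-monoʳ-≤-nonNeg r {{nonNegative 0≤r}}

0≤p+q : ∀ {p q} → 0ℚ ≤ p → 0ℚ ≤ q → 0ℚ ≤ p + q
0≤p+q = +-mono-≤ {0ℚ} {_} {0ℚ}

0≤p*q : ∀ {p q} → 0ℚ ≤ p → 0ℚ ≤ q → 0ℚ ≤ p * q
0≤p*q {p} {q} 0≤p 0≤q = subst (_≤ p * q) (*-zeroʳ p) (*-monoˡ-≤ 0≤p 0≤q)

*-mono-≤ : ∀ {p p′ q q′} → 0ℚ ≤ q → 0ℚ ≤ p′ → p ≤ p′ → q ≤ q′ → p * q ≤ p′ * q′
*-mono-≤ 0≤q 0≤p′ p≤p′ q≤q′ = ≤-trans (*-monoʳ-≤ 0≤q p≤p′) (*-monoˡ-≤ 0≤p′ q≤q′)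

p≤p+q : ∀ {p q} → 0ℚ ≤ q → p ≤ p + q
p≤p+q {p} {q} 0≤q = subst (_≤ p + q) (+-identityʳ p) (+-monoʳ-≤ p 0≤q)

p≤q+p : ∀ {p q} → 0ℚ ≤ q → p ≤ q + p
p≤q+p {p} {q} 0≤q = subst (_≤ q + p) (+-identityˡ p) (+-monoˡ-≤ p 0≤q)

p≤∣p∣ : ∀ p → p ≤ ∣ p ∣
p≤∣p∣ p with ≤-total 0ℚ p
... | inj₁ 0≤p = ≤-reflexive (sym (0≤p⇒∣p∣≡p 0≤p))
... | inj₂ p≤0 = ≤-trans p≤0 (0≤∣p∣ p)

∣p-q∣≡∣q-p∣ : ∀ p q → ∣ p - q ∣ ≡ ∣ q - p ∣
∣p-q∣≡∣q-p∣ p q = trans (sym (∣-p∣≡∣p∣ (p - q)))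
  (cong ∣_∣ (solve 2 (λ p q → :- (p :- q) := q :- p) refl p q))

∣p-p∣≡0 : ∀ p → ∣ p - p ∣ ≡ 0ℚ
∣p-p∣≡0 p = cong ∣_∣ (+-inverseʳ p)

∣pq-rs∣≤ : ∀ p q r s → ∣ p * q - r * s ∣ ≤ ∣ p ∣ * ∣ q - s ∣ + ∣ s ∣ * ∣ p - r ∣
∣pq-rs∣≤ p q r s = begin
  ∣ p * q - r * s ∣                     ≡⟨ cong ∣_∣ (solve 4 (λ p q r s →
                                             p :* q :- r :* s := p :* (q :- s) :+ s :* (p :- r))
                                             refl p q r s) ⟩
  ∣ p * (q - s) + s * (p - r) ∣         ≤⟨ ∣p+q∣≤∣p∣+∣q∣ (p * (q - s)) (s * (p - r)) ⟩
  ∣ p * (q - s) ∣ + ∣ s * (p - r) ∣     ≡⟨ cong₂ _+_ (∣p*q∣≡∣p∣*∣q∣ p (q - s)) (∣p*q∣≡∣p∣*∣q∣ s (p - r)) ⟩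
  ∣ p ∣ * ∣ q - s ∣ + ∣ s ∣ * ∣ p - r ∣ ∎
  where open ≤-Reasoning

∣pq-rs∣≤′ : ∀ p q r s {P S} → ∣ p ∣ ≤ P → ∣ s ∣ ≤ S →
  ∣ p * q - r * s ∣ ≤ P * ∣ q - s ∣ + S * ∣ p - r ∣
∣pq-rs∣≤′ p q r s {P} {S} p≤P s≤S = ≤-trans (∣pq-rs∣≤ p q r s)
  (+-mono-≤ {∣ p ∣ * ∣ q - s ∣} {P * ∣ q - s ∣} {∣ s ∣ * ∣ p - r ∣} {S * ∣ p - r ∣}
    (*-monoʳ-≤ {∣ q - s ∣} {∣ p ∣} {P} (0≤∣p∣ (q - s)) p≤P)
    (*-monoʳ-≤ {∣ p - r ∣} {∣ s ∣} {S} (0≤∣p∣ (p - r)) s≤S))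

∣p+q-r-s∣≤ : ∀ p q r s → ∣ (p + q) - (r + s) ∣ ≤ ∣ p - r ∣ + ∣ q - s ∣
∣p+q-r-s∣≤ p q r s = subst (_≤ ∣ p - r ∣ + ∣ q - s ∣)
  (cong ∣_∣ (solve 4 (λ p q r s → (p :- r) :+ (q :- s) := (p :+ q) :- (r :+ s)) refl p q r s))
  (∣p+q∣≤∣p∣+∣q∣ (p - r) (q - s))

∣-p--q∣≡∣p-q∣ : ∀ p q → ∣ - p - - q ∣ ≡ ∣ p - q ∣
∣-p--q∣≡∣p-q∣ p q = trans (cong ∣_∣ (solve 2 (λ p q → :- p :- :- q := :- (p :- q)) refl p q))
                          (∣-p∣≡∣p∣ (p - q))

ι : ℕ → ℚ
ι n = + n / 1

fromℚᵘ-homo-+ : ∀ p q → fromℚᵘ (p ℚᵘ.+ q) ≡ fromℚᵘ p + fromℚᵘ q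
fromℚᵘ-homo-+ p q = toℚᵘ-injective (ℚᵘ.≃-trans (toℚᵘ-fromℚᵘ (p ℚᵘ.+ q)) (ℚᵘ.≃-sym
  (ℚᵘ.≃-trans (toℚᵘ-homo-+ (fromℚᵘ p) (fromℚᵘ q)) (ℚᵘ.+-cong (toℚᵘ-fromℚᵘ p) (toℚᵘ-fromℚᵘ q)))))

fromℚᵘ-homo-* : ∀ p q → fromℚᵘ (p ℚᵘ.* q) ≡ fromℚᵘ p * fromℚᵘ q
fromℚᵘ-homo-* p q = toℚᵘ-injective (ℚᵘ.≃-trans (toℚᵘ-fromℚᵘ (p ℚᵘ.* q)) (ℚᵘ.≃-sym
  (ℚᵘ.≃-trans (toℚᵘ-homo-* (fromℚᵘ p) (fromℚᵘ q)) (ℚᵘ.*-cong (toℚᵘ-fromℚᵘ p) (toℚᵘ-fromℚᵘ q)))))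

ι-+ : ∀ m n → ι (m ℕ.+ n) ≡ ι m + ι n
ι-+ m n = trans (fromℚᵘ-cong {ℚᵘ.mkℚᵘ (+ (m ℕ.+ n)) 0} {ℚᵘ.mkℚᵘ (+ m) 0 ℚᵘ.+ ℚᵘ.mkℚᵘ (+ n) 0}
                   (ℚᵘ.*≡* (cong (ℤ._* + 1) (sym (cong₂ ℤ._+_ (ℤ.*-identityʳ (+ m)) (ℤ.*-identityʳ (+ n)))))))
                (fromℚᵘ-homo-+ (ℚᵘ.mkℚᵘ (+ m) 0) (ℚᵘ.mkℚᵘ (+ n) 0))

ι-* : ∀ m n → ι (m ℕ.* n) ≡ ι m * ι n
ι-* m n = trans (fromℚᵘ-cong {ℚᵘ.mkℚᵘ (+ (m ℕ.* n)) 0} {ℚᵘ.mkℚᵘ (+ m) 0 ℚᵘ.* ℚᵘ.mkℚᵘ (+ n) 0}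
                   (ℚᵘ.*≡* (cong (ℤ._* + 1) (ℤ.pos-* m n))))
                (fromℚᵘ-homo-* (ℚᵘ.mkℚᵘ (+ m) 0) (ℚᵘ.mkℚᵘ (+ n) 0))

0≤ι : ∀ n → 0ℚ ≤ ι n
0≤ι n = nonNegative⁻¹ (ι n) {{normalize-nonNeg n 1}}

ι-mono : ∀ {m n} → m ℕ.≤ n → ι m ≤ ι n
ι-mono {m} m≤n with ℕ.m≤n⇒∃[o]m+o≡n m≤n
... | o , refl = subst (ι m ≤_) (sym (ι-+ m o)) (p≤p+q (0≤ι o))

1/n*n≡1 : ∀ n .{{_ : ℕ.NonZero n}} → (+ 1 / n) * ι n ≡ 1ℚ
1/n*n≡1 (suc m) = trans (sym (fromℚᵘ-homo-* (ℚᵘ.mkℚᵘ (+ 1) m) (ℚᵘ.mkℚᵘ (+ suc m) 0)))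
  (fromℚᵘ-cong {ℚᵘ.mkℚᵘ (+ 1) m ℚᵘ.* ℚᵘ.mkℚᵘ (+ suc m) 0} {ℚᵘ.1ℚᵘ}
    (ℚᵘ.*≡* (trans (ℤ.*-identityʳ (+ 1 ℤ.* + suc m)) (cong (+ 1 ℤ.*_) (cong +_ (sym (ℕ.*-identityʳ (suc m))))))))

archimedean : ∀ p → ∃[ n ] p ≤ ι n
archimedean p@(mkℚ (+ n) d _) = n , toℚᵘ-cancel-≤
  (ℚᵘ.≤-respʳ-≃ (ℚᵘ.≃-sym (toℚᵘ-fromℚᵘ (ℚᵘ.mkℚᵘ (+ n) 0)))
    (ℚᵘ.*≤* (ℤ.*-monoˡ-≤-nonNeg (+ n) (ℤ.+≤+ (ℕ.s≤s ℕ.z≤n)))))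
archimedean p@(mkℚ -[1+ n ] d c) = 0 , <⇒≤ (negative⁻¹ p)

archimedean-* : ∀ p ε → 0ℚ < ε → ∃[ n ] p < ε * ι n
archimedean-* p ε 0<ε with archimedean (p * 1/ε)
  where
  instance _ = positive 0<ε
  instance _ = pos⇒nonZero ε
  1/ε = 1/ ε
... | n , le = suc n , (begin-strict
  p                      ≡⟨ sym (*-identityʳ p) ⟩
  p * 1ℚ                 ≡⟨ cong (p *_) (sym (*-inverseʳ ε)) ⟩
  p * (ε * 1/ ε)         ≡⟨ solve 3 (λ p e f → p :* (e :* f) := e :* (p :* f)) refl p ε (1/ ε) ⟩
  ε * (p * 1/ ε)         ≤⟨ *-monoˡ-≤ (<⇒≤ 0<ε) le ⟩
  ε * ι n                ≡⟨ sym (+-identityˡ _) ⟩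
  0ℚ + ε * ι n           <⟨ +-monoˡ-< (ε * ι n) 0<ε ⟩
  ε + ε * ι n            ≡⟨ solve 2 (λ e n → e :+ e :* n := e :* (con 1ℚ :+ n)) refl ε (ι n) ⟩
  ε * (1ℚ + ι n)         ≡⟨ cong (ε *_) (sym (ι-+ 1 n)) ⟩
  ε * ι (suc n)          ∎)
  where
  open ≤-Reasoning
  instance _ = positive 0<ε
  instance _ = pos⇒nonZero ε

------------------------------------------------------------------------
-- Double sequences of rationals that become small

Vanishing : (ℕ → ℕ → ℚ) → Set
Vanishing u = ∀ ε → 0ℚ < ε → ∃[ N ] ∀ m n → N ℕ.≤ m → N ℕ.≤ n → u m n < ε

vanish-mono : ∀ {u v} → (∀ m n → u m n ≤ v m n) → Vanishing v → Vanishing u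
vanish-mono u≤v V ε 0<ε with V ε 0<ε
... | N , h = N , λ m n N≤m N≤n → ≤-<-trans (u≤v m n) (h m n N≤m N≤n)

vanish-+ : ∀ {u v} → Vanishing u → Vanishing v → Vanishing (λ m n → u m n + v m n)
vanish-+ {u} {v} U V ε 0<ε with U (½ * ε) 0<ε/2 | V (½ * ε) 0<ε/2
  where
  0<ε/2 : 0ℚ < ½ * ε
  0<ε/2 = subst (_< ½ * ε) (*-zeroʳ ½) (*-monoʳ-<-pos ½ 0<ε)
... | N , h | M , k = N ℕ.⊔ M , λ m n l l′ → subst (u m n + v m n <_)
      (trans (sym (*-distribʳ-+ ε ½ ½)) (*-identityˡ ε))
      (+-mono-< (h m n (ℕ.m⊔n≤o⇒m≤o N M l) (ℕ.m⊔n≤o⇒m≤o N M l′))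
                (k m n (ℕ.m⊔n≤o⇒n≤o N M l) (ℕ.m⊔n≤o⇒n≤o N M l′)))

vanish-* : ∀ L .{{_ : Positive L}} {u} → Vanishing u → Vanishing (λ m n → L * u m n)
vanish-* L {u} U ε 0<ε with U (1/L * ε) (subst (_< 1/L * ε) (*-zeroʳ 1/L) (*-monoʳ-<-pos 1/L {{1/pos⇒pos L}} 0<ε))
  where
  instance _ = pos⇒nonZero L
  1/L = 1/ L
... | N , h = N , λ m n l l′ → subst (L * u m n <_)
        (trans (sym (*-assoc L (1/ L) ε)) (trans (cong (_* ε) (*-inverseʳ L)) (*-identityˡ ε)))
        (*-monoʳ-<-pos L (h m n l l′))
  where instance _ = pos⇒nonZero L

------------------------------------------------------------------------
-- Real numbers

-- Cauchy sequences of rationals, with _≈ᴿ_ as equality.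

record ℝ : Set where
  no-eta-equality
  constructor mkℝ
  field
    seq    : ℕ → ℚ
    cauchy : ∀ ε → 0ℚ < ε → ∃[ N ] ∀ m n → N ℕ.≤ m → N ℕ.≤ n → ∣ seq m - seq n ∣ < ε

open ℝ public

infix 4 _≈ᴿ_

record _≈ᴿ_ (x y : ℝ) : Set where
  constructor mk≈ᴿ
  field
    close : ∀ ε → 0ℚ < ε → ∃[ N ] ∀ n → N ℕ.≤ n → ∣ seq x n - seq y n ∣ < ε

open _≈ᴿ_ public

diff-vanishing : ∀ {x y} → x ≈ᴿ y → Vanishing (λ m n → ∣ seq x n - seq y n ∣)
diff-vanishing x≈y ε 0<ε with close x≈y ε 0<ε
... | N , h = N , λ m n _ N≤n → h n N≤n

vanishing⇒≈ᴿ : ∀ {x y u} → Vanishing u → (∀ n → ∣ seq x n - seq y n ∣ ≤ u n n) → x ≈ᴿ y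
vanishing⇒≈ᴿ V le = mk≈ᴿ λ ε 0<ε → let N , h = V ε 0<ε in
  N , λ n N≤n → ≤-<-trans (le n) (h n n N≤n N≤n)

pointwise⇒≈ᴿ : ∀ {x y} → (∀ n → seq x n ≡ seq y n) → x ≈ᴿ y
pointwise⇒≈ᴿ {x} {y} eq = mk≈ᴿ λ ε 0<ε → 0 , λ n _ →
  subst (_< ε) (sym (trans (cong (λ q → ∣ q - seq y n ∣) (eq n)) (∣p-p∣≡0 (seq y n)))) 0<ε

≈ᴿ-refl : ∀ {x} → x ≈ᴿ x
≈ᴿ-refl = pointwise⇒≈ᴿ λ _ → refl

≈ᴿ-sym : ∀ {x y} → x ≈ᴿ y → y ≈ᴿ x
≈ᴿ-sym {x} {y} x≈y = vanishing⇒≈ᴿ (diff-vanishing x≈y) λ n →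
  ≤-reflexive (∣p-q∣≡∣q-p∣ (seq y n) (seq x n))

≈ᴿ-trans : ∀ {x y z} → x ≈ᴿ y → y ≈ᴿ z → x ≈ᴿ z
≈ᴿ-trans {x} {y} {z} x≈y y≈z =
  vanishing⇒≈ᴿ (vanish-+ (diff-vanishing x≈y) (diff-vanishing y≈z)) λ n →
    subst (_≤ ∣ seq x n - seq y n ∣ + ∣ seq y n - seq z n ∣)
      (cong ∣_∣ (solve 3 (λ x y z → (x :- y) :+ (y :- z) := x :- z) refl (seq x n) (seq y n) (seq z n)))
      (∣p+q∣≤∣p∣+∣q∣ (seq x n - seq y n) (seq y n - seq z n))

private
  sumAbs : (ℕ → ℚ) → ℕ → ℚ
  sumAbs x zero    = ∣ x 0 ∣
  sumAbs x (suc n) = sumAbs x n + ∣ x (suc n) ∣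

  ∣x∣≤sumAbs : ∀ x {n} → ∣ x n ∣ ≤ sumAbs x n
  ∣x∣≤sumAbs x {zero}  = ≤-refl
  ∣x∣≤sumAbs x {suc n} = p≤q+p (0≤sumAbs n)
    where
    0≤sumAbs : ∀ n → 0ℚ ≤ sumAbs x n
    0≤sumAbs zero    = 0≤∣p∣ (x 0)
    0≤sumAbs (suc n) = 0≤p+q (0≤sumAbs n) (0≤∣p∣ (x (suc n)))

  sumAbs-mono : ∀ x {m n} → m ℕ.≤′ n → sumAbs x m ≤ sumAbs x n
  sumAbs-mono x (ℕ.≤′-reflexive refl)     = ≤-refl
  sumAbs-mono x {n = suc n} (ℕ.≤′-step l) = ≤-trans (sumAbs-mono x l) (p≤p+q (0≤∣p∣ (x (suc n))))

bounded : ∀ x → ∃[ B ] Positive B × (∀ n → ∣ seq x n ∣ ≤ B)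
bounded r with cauchy r 1ℚ (positive⁻¹ 1ℚ)
... | N , h = B , B>0 , le
  where
  x = seq r
  0≤s : 0ℚ ≤ sumAbs x N
  0≤s = ≤-trans (0≤∣p∣ (x N)) (∣x∣≤sumAbs x)
  B = sumAbs x N + 1ℚ
  B>0 : Positive B
  B>0 = positive (<-≤-trans (positive⁻¹ 1ℚ) (p≤q+p 0≤s))
  le : ∀ n → ∣ x n ∣ ≤ B
  le n with ℕ.≤-total n N
  ... | inj₁ n≤N = ≤-trans (∣x∣≤sumAbs x) (≤-trans (sumAbs-mono x (ℕ.≤⇒≤′ n≤N)) (p≤p+q (<⇒≤ (positive⁻¹ 1ℚ))))
  ... | inj₂ N≤n = begin
    ∣ x n ∣                     ≡⟨ cong ∣_∣ (solve 2 (λ a b → a := b :+ (a :- b)) refl (x n) (x N)) ⟩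
    ∣ x N + (x n - x N) ∣       ≤⟨ ∣p+q∣≤∣p∣+∣q∣ (x N) (x n - x N) ⟩
    ∣ x N ∣ + ∣ x n - x N ∣     ≤⟨ +-mono-≤ (∣x∣≤sumAbs x {N}) (<⇒≤ (h n N N≤n ℕ.≤-refl)) ⟩
    sumAbs x N + 1ℚ             ∎
    where open ≤-Reasoning

infixl 6 _+ᴿ_ _-ᴿ_
infixl 7 _*ᴿ_
infix  8 -ᴿ_

fromℚ : ℚ → ℝ
seq    (fromℚ q) _     = q
cauchy (fromℚ q) ε 0<ε = 0 , λ _ _ _ _ → subst (_< ε) (sym (∣p-p∣≡0 q)) 0<ε

_+ᴿ_ : ℝ → ℝ → ℝ
seq    (x +ᴿ y) n = seq x n + seq y n
cauchy (x +ᴿ y)   = vanish-mono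
  (λ m n → ∣p+q-r-s∣≤ (seq x m) (seq y m) (seq x n) (seq y n))
  (vanish-+ (cauchy x) (cauchy y))

-ᴿ_ : ℝ → ℝ
seq    (-ᴿ x) n = - seq x n
cauchy (-ᴿ x)   = vanish-mono
  (λ m n → ≤-reflexive (∣-p--q∣≡∣p-q∣ (seq x m) (seq x n)))
  (cauchy x)

_-ᴿ_ : ℝ → ℝ → ℝ
x -ᴿ y = x +ᴿ (-ᴿ y)

_*ᴿ_ : ℝ → ℝ → ℝ
seq    (x *ᴿ y) n = seq x n * seq y n
cauchy (x *ᴿ y)   =
  let X , X>0 , x≤X = bounded x; Y , Y>0 , y≤Y = bounded y in vanish-mono
  (λ m n → ∣pq-rs∣≤′ (seq x m) (seq y m) (seq x n) (seq y n) (x≤X m) (y≤Y n))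
  (vanish-+ (vanish-* X {{X>0}} (cauchy y)) (vanish-* Y {{Y>0}} (cauchy x)))

+ᴿ-cong : ∀ {x x′ y y′} → x ≈ᴿ x′ → y ≈ᴿ y′ → x +ᴿ y ≈ᴿ x′ +ᴿ y′
+ᴿ-cong {x} {x′} {y} {y′} p q = vanishing⇒≈ᴿ (vanish-+ (diff-vanishing p) (diff-vanishing q))
  λ n → ∣p+q-r-s∣≤ (seq x n) (seq y n) (seq x′ n) (seq y′ n)

-ᴿ-cong : ∀ {x y} → x ≈ᴿ y → -ᴿ x ≈ᴿ -ᴿ y
-ᴿ-cong {x} {y} p = vanishing⇒≈ᴿ (diff-vanishing p)
  λ n → ≤-reflexive (∣-p--q∣≡∣p-q∣ (seq x n) (seq y n))

*ᴿ-cong : ∀ {x x′ y y′} → x ≈ᴿ x′ → y ≈ᴿ y′ → x *ᴿ y ≈ᴿ x′ *ᴿ y′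
*ᴿ-cong {x} {x′} {y} {y′} p q =
  let X , X>0 , x≤X = bounded x; Y , Y>0 , y≤Y = bounded y′ in vanishing⇒≈ᴿ
  (vanish-+ (vanish-* X {{X>0}} (diff-vanishing q)) (vanish-* Y {{Y>0}} (diff-vanishing p)))
  λ n → ∣pq-rs∣≤′ (seq x n) (seq y n) (seq x′ n) (seq y′ n) (x≤X n) (y≤Y n)

------------------------------------------------------------------------
-- Gaussian rationals

record ℚ[i] : Set where
  constructor mkℚ[i]
  field
    re im : ℚ

open ℚ[i] public

infixl 6 _⊕_ _⊖_
infixl 7 _⊗_ _·_
infixr 8 _⊗^_

0ᵍ 1ᵍ : ℚ[i]
0ᵍ = mkℚ[i] 0ℚ 0ℚ
1ᵍ = mkℚ[i] 1ℚ 0ℚ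

_⊕_ _⊖_ _⊗_ : ℚ[i] → ℚ[i] → ℚ[i]
w ⊕ v = mkℚ[i] (re w + re v) (im w + im v)
w ⊖ v = mkℚ[i] (re w - re v) (im w - im v)
w ⊗ v = mkℚ[i] (re w * re v - im w * im v) (re w * im v + im w * re v)

_·_ : ℚ → ℚ[i] → ℚ[i]
c · w = mkℚ[i] (c * re w) (c * im w)

_⊗^_ : ℚ[i] → ℕ → ℚ[i]
w ⊗^ zero  = 1ᵍ
w ⊗^ suc k = w ⊗ w ⊗^ k

invFact : ℕ → ℚ
invFact k = (+ 1 / (k !)) {{k ℕ.!≢0}}

-- expSum N w = Σ_{k<N} wᵏ / k!
expSum : ℕ → ℚ[i] → ℚ[i]
expSum zero    w = 0ᵍ
expSum (suc k) w = expSum k w ⊕ invFact k · w ⊗^ k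

‖_‖ : ℚ[i] → ℚ
‖ w ‖ = ∣ re w ∣ + ∣ im w ∣

0≤‖‖ : ∀ w → 0ℚ ≤ ‖ w ‖
0≤‖‖ w = 0≤p+q (0≤∣p∣ (re w)) (0≤∣p∣ (im w))

∣re∣≤‖‖ : ∀ w → ∣ re w ∣ ≤ ‖ w ‖
∣re∣≤‖‖ w = p≤p+q (0≤∣p∣ (im w))

∣im∣≤‖‖ : ∀ w → ∣ im w ∣ ≤ ‖ w ‖
∣im∣≤‖‖ w = p≤q+p (0≤∣p∣ (re w))

‖⊕‖≤ : ∀ w v → ‖ w ⊕ v ‖ ≤ ‖ w ‖ + ‖ v ‖
‖⊕‖≤ (mkℚ[i] a b) (mkℚ[i] c d) = begin
  ∣ a + c ∣ + ∣ b + d ∣             ≤⟨ +-mono-≤ (∣p+q∣≤∣p∣+∣q∣ a c) (∣p+q∣≤∣p∣+∣q∣ b d) ⟩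
  ∣ a ∣ + ∣ c ∣ + (∣ b ∣ + ∣ d ∣)   ≡⟨ solve 4 (λ a b c d → a :+ c :+ (b :+ d) := a :+ b :+ (c :+ d))
                                        refl (∣ a ∣) (∣ b ∣) (∣ c ∣) (∣ d ∣) ⟩
  ∣ a ∣ + ∣ b ∣ + (∣ c ∣ + ∣ d ∣)   ∎
  where open ≤-Reasoning

‖⊗‖≤ : ∀ w v → ‖ w ⊗ v ‖ ≤ ‖ w ‖ * ‖ v ‖
‖⊗‖≤ (mkℚ[i] a b) (mkℚ[i] c d) = begin
  ∣ a * c - b * d ∣ + ∣ a * d + b * c ∣
    ≤⟨ +-mono-≤ (∣p-q∣≤∣p∣+∣q∣ (a * c) (b * d)) (∣p+q∣≤∣p∣+∣q∣ (a * d) (b * c)) ⟩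
  ∣ a * c ∣ + ∣ b * d ∣ + (∣ a * d ∣ + ∣ b * c ∣)
    ≡⟨ cong₂ _+_ (cong₂ _+_ (∣p*q∣≡∣p∣*∣q∣ a c) (∣p*q∣≡∣p∣*∣q∣ b d))
                 (cong₂ _+_ (∣p*q∣≡∣p∣*∣q∣ a d) (∣p*q∣≡∣p∣*∣q∣ b c)) ⟩
  ∣ a ∣ * ∣ c ∣ + ∣ b ∣ * ∣ d ∣ + (∣ a ∣ * ∣ d ∣ + ∣ b ∣ * ∣ c ∣)
    ≡⟨ solve 4 (λ a b c d → a :* c :+ b :* d :+ (a :* d :+ b :* c) := (a :+ b) :* (c :+ d))
        refl (∣ a ∣) (∣ b ∣) (∣ c ∣) (∣ d ∣) ⟩
  (∣ a ∣ + ∣ b ∣) * (∣ c ∣ + ∣ d ∣) ∎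
  where open ≤-Reasoning

‖·‖≡ : ∀ c w → 0ℚ ≤ c → ‖ c · w ‖ ≡ c * ‖ w ‖
‖·‖≡ c (mkℚ[i] a b) 0≤c = begin
  ∣ c * a ∣ + ∣ c * b ∣         ≡⟨ cong₂ _+_ (∣p*q∣≡∣p∣*∣q∣ c a) (∣p*q∣≡∣p∣*∣q∣ c b) ⟩
  ∣ c ∣ * ∣ a ∣ + ∣ c ∣ * ∣ b ∣ ≡⟨ sym (*-distribˡ-+ (∣ c ∣) (∣ a ∣) (∣ b ∣)) ⟩
  ∣ c ∣ * (∣ a ∣ + ∣ b ∣)       ≡⟨ cong (_* (∣ a ∣ + ∣ b ∣)) (0≤p⇒∣p∣≡p 0≤c) ⟩
  c * (∣ a ∣ + ∣ b ∣)           ∎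
  where open ≡-Reasoning

‖⊖‖-sym : ∀ w v → ‖ w ⊖ v ‖ ≡ ‖ v ⊖ w ‖
‖⊖‖-sym w v = cong₂ _+_ (∣p-q∣≡∣q-p∣ (re w) (re v)) (∣p-q∣≡∣q-p∣ (im w) (im v))

‖⊖‖-triangle : ∀ u v w → ‖ u ⊖ w ‖ ≤ ‖ u ⊖ v ‖ + ‖ v ⊖ w ‖
‖⊖‖-triangle u v w = subst (_≤ ‖ u ⊖ v ‖ + ‖ v ⊖ w ‖)
  (cong ‖_‖ (cong₂ mkℚ[i] (telescope (re u) (re v) (re w)) (telescope (im u) (im v) (im w))))
  (‖⊕‖≤ (u ⊖ v) (v ⊖ w))
  where
  telescope : ∀ p q r → (p - q) + (q - r) ≡ p - r
  telescope = solve 3 (λ p q r → (p :- q) :+ (q :- r) := p :- r) refl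

0≤invFact : ∀ k → 0ℚ ≤ invFact k
0≤invFact k = nonNegative⁻¹ (invFact k) {{normalize-nonNeg 1 (k !) {{k ℕ.!≢0}}}}

invFact-suc : ∀ k → invFact (suc k) * ι (suc k) ≡ invFact k
invFact-suc k = begin
  c′ * ι (suc k)                         ≡⟨ sym (*-identityʳ _) ⟩
  c′ * ι (suc k) * 1ℚ                    ≡⟨ cong (c′ * ι (suc k) *_) (sym (1/n*n≡1 (k !) {{k ℕ.!≢0}})) ⟩
  c′ * ι (suc k) * (c * ι (k !))         ≡⟨ solve 4 (λ c′ s c f → c′ :* s :* (c :* f) := c :* (c′ :* (s :* f)))
                                              refl c′ (ι (suc k)) c (ι (k !)) ⟩
  c * (c′ * (ι (suc k) * ι (k !)))       ≡⟨ cong (λ q → c * (c′ * q)) (sym (ι-* (suc k) (k !))) ⟩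
  c * (c′ * ι (suc k !))                 ≡⟨ cong (c *_) (1/n*n≡1 (suc k !) {{suc k ℕ.!≢0}}) ⟩
  c * 1ℚ                                 ≡⟨ *-identityʳ c ⟩
  c                                      ∎
  where
  open ≡-Reasoning
  c  = invFact k
  c′ = invFact (suc k)

------------------------------------------------------------------------
-- Convergence of the exponential series, uniformly on ‖ w ‖ ≤ B

module ExpBounds (B : ℚ) (0≤B : 0ℚ ≤ B) where

  power : ℕ → ℚ
  power zero    = 1ℚ
  power (suc k) = B * power k

  0≤power : ∀ k → 0ℚ ≤ power k
  0≤power zero    = <⇒≤ (positive⁻¹ 1ℚ)
  0≤power (suc k) = 0≤p*q 0≤B (0≤power k)

  term : ℕ → ℚ
  term k = invFact k * power k

  0≤term : ∀ k → 0ℚ ≤ term k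
  0≤term k = 0≤p*q (0≤invFact k) (0≤power k)

  majorant : ℕ → ℚ
  majorant zero    = 0ℚ
  majorant (suc k) = majorant k + term k

  term-suc : ∀ k → ι (suc k) * term (suc k) ≡ B * term k
  term-suc k = begin
    ι (suc k) * (invFact (suc k) * (B * power k)) ≡⟨ solve 4 (λ s c b p → s :* (c :* (b :* p)) := b :* ((c :* s) :* p))
                                                  refl (ι (suc k)) (invFact (suc k)) B (power k) ⟩
    B * ((invFact (suc k) * ι (suc k)) * power k) ≡⟨ cong (λ q → B * (q * power k)) (invFact-suc k) ⟩
    B * (invFact k * power k)                   ∎
    where open ≡-Reasoning

  M : ℕ
  M = proj₁ (archimedean (B + B))

  2B≤M : B + B ≤ ι M
  2B≤M = proj₂ (archimedean (B + B))

  halving : ∀ k → M ℕ.≤ k → term (suc k) + term (suc k) ≤ term k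
  halving k M≤k = *-cancelˡ-≤-pos (ι (suc k)) {{normalize-pos (suc k) 1}} (begin
    ι (suc k) * (term (suc k) + term (suc k))             ≡⟨ *-distribˡ-+ (ι (suc k)) (term (suc k)) (term (suc k)) ⟩
    ι (suc k) * term (suc k) + ι (suc k) * term (suc k)   ≡⟨ cong₂ _+_ (term-suc k) (term-suc k) ⟩
    B * term k + B * term k                               ≡⟨ sym (*-distribʳ-+ (term k) B B) ⟩
    (B + B) * term k                                      ≤⟨ *-monoʳ-≤ (0≤term k) 2B≤M ⟩
    ι M * term k                                          ≤⟨ *-monoʳ-≤ (0≤term k) (ι-mono (ℕ.m≤n⇒m≤1+n M≤k)) ⟩
    ι (suc k) * term k                                    ∎)
    where open ≤-Reasoning

  decay : ∀ j → ι (suc j) * term (j ℕ.+ M) ≤ term M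
  decay zero    = ≤-reflexive (*-identityˡ (term M))
  decay (suc j) = begin
    ι (2 ℕ.+ j) * t′               ≡⟨ cong (_* t′) (ι-+ 1 (suc j)) ⟩
    (ι 1 + ι (suc j)) * t′         ≤⟨ *-monoʳ-≤ (0≤term (suc j ℕ.+ M))
                                        (+-monoˡ-≤ (ι (suc j)) (ι-mono {1} {suc j} (ℕ.s≤s ℕ.z≤n))) ⟩
    (ι (suc j) + ι (suc j)) * t′   ≡⟨ solve 2 (λ s t → (s :+ s) :* t := s :* (t :+ t)) refl (ι (suc j)) t′ ⟩
    ι (suc j) * (t′ + t′)          ≤⟨ *-monoˡ-≤ (0≤ι (suc j)) (halving (j ℕ.+ M) (ℕ.m≤n+m M j)) ⟩
    ι (suc j) * term (j ℕ.+ M)     ≤⟨ decay j ⟩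
    term M                         ∎
    where
    open ≤-Reasoning
    t′ = term (suc j ℕ.+ M)

  term-vanishing : ∀ ε → 0ℚ < ε → ∃[ N ] ∀ n → N ℕ.≤ n → term n < ε
  term-vanishing ε 0<ε = let J , lt = archimedean-* (term M) ε 0<ε in
    J ℕ.+ M , λ n l →
      let j = n ℕ.∸ M in
      subst (λ n → term n < ε) (ℕ.m∸n+n≡m (ℕ.m+n≤o⇒n≤o J l))
        (*-cancelˡ-<-nonNeg (ι (suc j)) {{normalize-nonNeg (suc j) 1}}
          (≤-<-trans (decay j) (<-≤-trans lt
            (subst (ε * ι J ≤_) (*-comm ε (ι (suc j)))
              (*-monoˡ-≤ (<⇒≤ 0<ε) (ι-mono (ℕ.m≤n⇒m≤1+n (ℕ.m+n≤o⇒m≤o∸n J l))))))))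

  majorant-mono : ∀ {m n} → m ℕ.≤′ n → majorant m ≤ majorant n
  majorant-mono (ℕ.≤′-reflexive refl)     = ≤-refl
  majorant-mono {n = suc n} (ℕ.≤′-step l) = ≤-trans (majorant-mono l) (p≤p+q (0≤term n))

  majorant-tail : ∀ {m n} → M ℕ.≤ m → m ℕ.≤′ n →
    majorant n + (term n + term n) ≤ majorant m + (term m + term m)
  majorant-tail M≤m (ℕ.≤′-reflexive refl) = ≤-refl
  majorant-tail {m} {suc n} M≤m (ℕ.≤′-step l) = begin
    majorant n + term n + (term (suc n) + term (suc n)) ≤⟨ +-monoʳ-≤ (majorant n + term n)
                                                            (halving n (ℕ.≤-trans M≤m (ℕ.≤′⇒≤ l))) ⟩
    majorant n + term n + term n                        ≡⟨ +-assoc (majorant n) (term n) (term n) ⟩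
    majorant n + (term n + term n)                      ≤⟨ majorant-tail M≤m l ⟩
    majorant m + (term m + term m)                      ∎
    where open ≤-Reasoning

  majorant-diff : ∀ {m n} → M ℕ.≤ m → m ℕ.≤ n →
    majorant n - majorant m ≤ term m + term m
  majorant-diff {m} {n} M≤m m≤n = begin
    majorant n - majorant m                       ≤⟨ +-monoˡ-≤ (- majorant m) (p≤p+q {majorant n} (0≤p+q (0≤term n) (0≤term n))) ⟩
    majorant n + (term n + term n) - majorant m   ≤⟨ +-monoˡ-≤ (- majorant m) (majorant-tail M≤m (ℕ.≤⇒≤′ m≤n)) ⟩
    majorant m + (term m + term m) - majorant m   ≡⟨ solve 2 (λ s t → s :+ t :- s := t) refl (majorant m) (term m + term m) ⟩
    term m + term m                               ∎
    where open ≤-Reasoning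

  majorant-cauchy : Vanishing (λ m n → ∣ majorant m - majorant n ∣)
  majorant-cauchy ε 0<ε =
    let N , h = vanish-+ (λ ε 0<ε → let N , h = term-vanishing ε 0<ε in N , λ m _ l _ → h m l)
                         (λ ε 0<ε → let N , h = term-vanishing ε 0<ε in N , λ m _ l _ → h m l) ε 0<ε
        ordered : ∀ {m n} → N ℕ.⊔ M ℕ.≤ m → m ℕ.≤ n → ∣ majorant n - majorant m ∣ < ε
        ordered {m} {n} l m≤n = subst (_< ε)
          (sym (0≤p⇒∣p∣≡p (subst (_≤ majorant n - majorant m) (+-inverseʳ (majorant m))
             (+-monoˡ-≤ (- majorant m) (majorant-mono (ℕ.≤⇒≤′ m≤n))))))
          (≤-<-trans (majorant-diff (ℕ.m⊔n≤o⇒n≤o N M l) m≤n)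
             (h m m (ℕ.m⊔n≤o⇒m≤o N M l) (ℕ.m⊔n≤o⇒m≤o N M l)))
    in N ℕ.⊔ M , λ m n l l′ → case m n l l′ (λ {m} {n} → ordered {m} {n}) (ℕ.≤-total m n)
    where
    case : ∀ m n {K} → K ℕ.≤ m → K ℕ.≤ n →
      (∀ {m n} → K ℕ.≤ m → m ℕ.≤ n → ∣ majorant n - majorant m ∣ < ε) →
      m ℕ.≤ n ⊎ n ℕ.≤ m → ∣ majorant m - majorant n ∣ < ε
    case m n l l′ ordered (inj₁ m≤n) =
      subst (_< ε) (∣p-q∣≡∣q-p∣ (majorant n) (majorant m)) (ordered l m≤n)
    case m n l l′ ordered (inj₂ n≤m) = ordered l′ n≤m

  majorant-bounded : ∃[ L ] Positive L × (∀ n → majorant n ≤ L)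
  majorant-bounded = let L , L>0 , h = bounded (mkℝ majorant majorant-cauchy) in
    L , L>0 , λ n → ≤-trans (p≤∣p∣ (majorant n)) (h n)

  ‖pow‖≤ : ∀ {w} → ‖ w ‖ ≤ B → ∀ k → ‖ w ⊗^ k ‖ ≤ power k
  ‖pow‖≤     w≤B zero    = ≤-refl
  ‖pow‖≤ {w} w≤B (suc k) = ≤-trans (‖⊗‖≤ w (w ⊗^ k))
    (*-mono-≤ (0≤‖‖ (w ⊗^ k)) 0≤B w≤B (‖pow‖≤ w≤B k))

  ‖expSum-tail‖≤ : ∀ {w} → ‖ w ‖ ≤ B → ∀ {m n} → m ℕ.≤′ n →
    ‖ expSum n w ⊖ expSum m w ‖ ≤ majorant n - majorant m
  ‖expSum-tail‖≤ {w} w≤B {m} (ℕ.≤′-reflexive refl) = ≤-reflexive (begin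
    ‖ S ⊖ S ‖               ≡⟨ cong₂ _+_ (∣p-p∣≡0 (re S)) (∣p-p∣≡0 (im S)) ⟩
    0ℚ                      ≡⟨ sym (+-inverseʳ (majorant m)) ⟩
    majorant m - majorant m ∎)
    where
    open ≡-Reasoning
    S = expSum m w
  ‖expSum-tail‖≤ {w} w≤B {m} {suc n} (ℕ.≤′-step l) = begin
    ‖ (S ⊕ t) ⊖ S₀ ‖               ≡⟨ cong ‖_‖ (cong₂ mkℚ[i] (swap (re S) (re t) (re S₀)) (swap (im S) (im t) (im S₀))) ⟩
    ‖ (S ⊖ S₀) ⊕ t ‖               ≤⟨ ‖⊕‖≤ (S ⊖ S₀) t ⟩
    ‖ S ⊖ S₀ ‖ + ‖ t ‖             ≤⟨ +-mono-≤ (‖expSum-tail‖≤ w≤B l)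
                                        (≤-trans (≤-reflexive (‖·‖≡ (invFact n) (w ⊗^ n) (0≤invFact n)))
                                                 (*-monoˡ-≤ (0≤invFact n) (‖pow‖≤ w≤B n))) ⟩
    majorant n - majorant m + term n ≡⟨ sym (swap (majorant n) (term n) (majorant m)) ⟩
    majorant n + term n - majorant m ∎
    where
    open ≤-Reasoning
    S = expSum n w
    S₀ = expSum m w
    t = invFact n · w ⊗^ n
    swap : ∀ p q r → p + q - r ≡ p - r + q
    swap = solve 3 (λ p q r → p :+ q :- r := p :- r :+ q) refl

  ‖expSum⊖expSum‖≤ : ∀ {w} → ‖ w ‖ ≤ B → ∀ m n →
    ‖ expSum m w ⊖ expSum n w ‖ ≤ ∣ majorant m - majorant n ∣
  ‖expSum⊖expSum‖≤ {w} w≤B m n with ℕ.≤-total m n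
  ... | inj₁ m≤n = ≤-trans (≤-reflexive (‖⊖‖-sym (expSum m w) (expSum n w)))
        (≤-trans (‖expSum-tail‖≤ w≤B (ℕ.≤⇒≤′ m≤n))
        (≤-trans (p≤∣p∣ (majorant n - majorant m)) (≤-reflexive (∣p-q∣≡∣q-p∣ (majorant n) (majorant m)))))
  ... | inj₂ n≤m = ≤-trans (‖expSum-tail‖≤ w≤B (ℕ.≤⇒≤′ n≤m)) (p≤∣p∣ (majorant m - majorant n))

  powerLip : ℕ → ℚ
  powerLip zero    = 0ℚ
  powerLip (suc k) = ι (suc k) * power k

  B*powerLip : ∀ k → B * powerLip k ≡ ι k * power k
  B*powerLip zero    = *-zeroʳ B
  B*powerLip (suc k) = solve 3 (λ b s p → b :* (s :* p) := s :* (b :* p)) refl B (ι (suc k)) (power k)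

  ‖pow⊖pow‖≤ : ∀ {w v} → ‖ w ‖ ≤ B → ‖ v ‖ ≤ B → ∀ k →
    ‖ w ⊗^ k ⊖ v ⊗^ k ‖ ≤ powerLip k * ‖ w ⊖ v ‖
  ‖pow⊖pow‖≤ {w} {v} w≤B v≤B zero = ≤-reflexive (sym (*-zeroˡ ‖ w ⊖ v ‖))
  ‖pow⊖pow‖≤ {w} {v} w≤B v≤B (suc k) = begin
    ‖ w ⊗ W ⊖ v ⊗ V ‖                       ≡⟨ cong ‖_‖ (cong₂ mkℚ[i]
                                                 (split-re (re w) (im w) (re v) (im v) (re W) (im W) (re V) (im V))
                                                 (split-im (re w) (im w) (re v) (im v) (re W) (im W) (re V) (im V))) ⟩
    ‖ w ⊗ (W ⊖ V) ⊕ (w ⊖ v) ⊗ V ‖           ≤⟨ ‖⊕‖≤ (w ⊗ (W ⊖ V)) ((w ⊖ v) ⊗ V) ⟩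
    ‖ w ⊗ (W ⊖ V) ‖ + ‖ (w ⊖ v) ⊗ V ‖       ≤⟨ +-mono-≤ (‖⊗‖≤ w (W ⊖ V)) (‖⊗‖≤ (w ⊖ v) V) ⟩
    ‖ w ‖ * ‖ W ⊖ V ‖ + d * ‖ V ‖           ≤⟨ +-mono-≤
                                                 (*-mono-≤ (0≤‖‖ (W ⊖ V)) 0≤B w≤B (‖pow⊖pow‖≤ w≤B v≤B k))
                                                 (*-monoˡ-≤ (0≤‖‖ (w ⊖ v)) (‖pow‖≤ v≤B k)) ⟩
    B * (powerLip k * d) + d * power k      ≡⟨ cong (_+ d * power k) (trans (sym (*-assoc B (powerLip k) d))
                                                 (cong (_* d) (B*powerLip k))) ⟩
    ι k * power k * d + d * power k         ≡⟨ solve 3 (λ s p d → s :* p :* d :+ d :* p := (con 1ℚ :+ s) :* p :* d)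
                                                 refl (ι k) (power k) d ⟩
    (1ℚ + ι k) * power k * d                ≡⟨ cong (λ q → q * power k * d) (sym (ι-+ 1 k)) ⟩
    ι (suc k) * power k * d                 ∎
    where
    open ≤-Reasoning
    W = w ⊗^ k
    V = v ⊗^ k
    d = ‖ w ⊖ v ‖
    split-re : ∀ a b a′ b′ c e c′ e′ → (a * c - b * e) - (a′ * c′ - b′ * e′) ≡
      (a * (c - c′) - b * (e - e′)) + ((a - a′) * c′ - (b - b′) * e′)
    split-re = solve 8 (λ a b a′ b′ c e c′ e′ → (a :* c :- b :* e) :- (a′ :* c′ :- b′ :* e′) :=
      (a :* (c :- c′) :- b :* (e :- e′)) :+ ((a :- a′) :* c′ :- (b :- b′) :* e′)) refl
    split-im : ∀ a b a′ b′ c e c′ e′ → (a * e + b * c) - (a′ * e′ + b′ * c′) ≡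
      (a * (e - e′) + b * (c - c′)) + ((a - a′) * e′ + (b - b′) * c′)
    split-im = solve 8 (λ a b a′ b′ c e c′ e′ → (a :* e :+ b :* c) :- (a′ :* e′ :+ b′ :* c′) :=
      (a :* (e :- e′) :+ b :* (c :- c′)) :+ ((a :- a′) :* e′ :+ (b :- b′) :* c′)) refl

  expSum-lipschitz : ∀ {w v} → ‖ w ‖ ≤ B → ‖ v ‖ ≤ B → ∀ n →
    ‖ expSum n w ⊖ expSum n v ‖ ≤ majorant n * ‖ w ⊖ v ‖
  expSum-lipschitz {w} {v} w≤B v≤B zero = ≤-reflexive (sym (*-zeroˡ ‖ w ⊖ v ‖))
  expSum-lipschitz {w} {v} w≤B v≤B (suc n) =
    ≤-trans (sharper n) (*-monoʳ-≤ (0≤‖‖ (w ⊖ v)) (p≤p+q {majorant n} (0≤term n)))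
    where
    open ≤-Reasoning
    d = ‖ w ⊖ v ‖
    regroup : ∀ p q r s c → (p + c * q) - (r + c * s) ≡ (p - r) + c * (q - s)
    regroup = solve 5 (λ p q r s c → (p :+ c :* q) :- (r :+ c :* s) := (p :- r) :+ c :* (q :- s)) refl
    step : ∀ k {X} → ‖ expSum k w ⊖ expSum k v ‖ ≤ X →
      ‖ expSum (suc k) w ⊖ expSum (suc k) v ‖ ≤ X + invFact k * (powerLip k * d)
    step k {X} le = begin
      ‖ (S ⊕ c · W) ⊖ (S′ ⊕ c · V) ‖        ≡⟨ cong ‖_‖ (cong₂ mkℚ[i]
                                                 (regroup (re S) (re W) (re S′) (re V) c)
                                                 (regroup (im S) (im W) (im S′) (im V) c)) ⟩
      ‖ (S ⊖ S′) ⊕ c · (W ⊖ V) ‖            ≤⟨ ‖⊕‖≤ (S ⊖ S′) (c · (W ⊖ V)) ⟩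
      ‖ S ⊖ S′ ‖ + ‖ c · (W ⊖ V) ‖          ≤⟨ +-mono-≤ le
                                                 (≤-trans (≤-reflexive (‖·‖≡ c (W ⊖ V) (0≤invFact k)))
                                                          (*-monoˡ-≤ (0≤invFact k) (‖pow⊖pow‖≤ w≤B v≤B k))) ⟩
      X + c * (powerLip k * d)              ∎
      where
      c = invFact k
      S = expSum k w
      S′ = expSum k v
      W = w ⊗^ k
      V = v ⊗^ k
    sharper : ∀ n → ‖ expSum (suc n) w ⊖ expSum (suc n) v ‖ ≤ majorant n * d
    sharper zero = begin
      ‖ expSum 1 w ⊖ expSum 1 v ‖        ≤⟨ step 0 {0ℚ} ≤-refl ⟩
      0ℚ + 1ℚ * (0ℚ * d)                 ≡⟨ solve 1 (λ d → con 0ℚ :+ con 1ℚ :* (con 0ℚ :* d) := con 0ℚ :* d) refl d ⟩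
      0ℚ * d                             ∎
    sharper (suc n) = begin
      ‖ expSum (2 ℕ.+ n) w ⊖ expSum (2 ℕ.+ n) v ‖                ≤⟨ step (suc n) (sharper n) ⟩
      majorant n * d + invFact (suc n) * (ι (suc n) * power n * d)    ≡⟨ solve 5 (λ m d c s p →
                                                                      m :* d :+ c :* (s :* p :* d) := (m :+ (c :* s) :* p) :* d)
                                                                      refl (majorant n) d (invFact (suc n)) (ι (suc n)) (power n) ⟩
      (majorant n + (invFact (suc n) * ι (suc n)) * power n) * d      ≡⟨ cong (λ q → (majorant n + q * power n) * d) (invFact-suc n) ⟩
      (majorant n + term n) * d                                  ∎

------------------------------------------------------------------------
-- Complex numbers

infix  5 _+i_
infix  4 _≈ᶜ_
infixl 6 _+ᶜ_
infixl 7 _*ᶜ_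
infix  8 -ᶜ_

record ℂ : Set where
  no-eta-equality
  constructor _+i_
  field
    Re Im : ℝ

open ℂ public

record _≈ᶜ_ (z w : ℂ) : Set where
  constructor mk≈ᶜ
  field
    Re-≈ : Re z ≈ᴿ Re w
    Im-≈ : Im z ≈ᴿ Im w

open _≈ᶜ_ public

_+ᶜ_ _*ᶜ_ : ℂ → ℂ → ℂ
Re (z +ᶜ w) = Re z +ᴿ Re w
Im (z +ᶜ w) = Im z +ᴿ Im w
Re (z *ᶜ w) = Re z *ᴿ Re w -ᴿ Im z *ᴿ Im w
Im (z *ᶜ w) = Re z *ᴿ Im w +ᴿ Im z *ᴿ Re w

-ᶜ_ : ℂ → ℂ
Re (-ᶜ z) = -ᴿ Re z
Im (-ᶜ z) = -ᴿ Im z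

approx : ℂ → ℕ → ℚ[i]
approx z n = mkℚ[i] (seq (Re z) n) (seq (Im z) n)

pointwise⇒≈ᶜ : ∀ {z w} → (∀ n → approx z n ≡ approx w n) → z ≈ᶜ w
pointwise⇒≈ᶜ eq = mk≈ᶜ (pointwise⇒≈ᴿ λ n → cong re (eq n)) (pointwise⇒≈ᴿ λ n → cong im (eq n))

≈ᶜ-refl : ∀ {z} → z ≈ᶜ z
≈ᶜ-refl = mk≈ᶜ ≈ᴿ-refl ≈ᴿ-refl

≈ᶜ-sym : ∀ {z w} → z ≈ᶜ w → w ≈ᶜ z
≈ᶜ-sym (mk≈ᶜ p q) = mk≈ᶜ (≈ᴿ-sym p) (≈ᴿ-sym q)

≈ᶜ-trans : ∀ {z w u} → z ≈ᶜ w → w ≈ᶜ u → z ≈ᶜ u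
≈ᶜ-trans (mk≈ᶜ p q) (mk≈ᶜ p′ q′) = mk≈ᶜ (≈ᴿ-trans p p′) (≈ᴿ-trans q q′)

+ᶜ-cong : ∀ {z z′ w w′} → z ≈ᶜ z′ → w ≈ᶜ w′ → z +ᶜ w ≈ᶜ z′ +ᶜ w′
+ᶜ-cong (mk≈ᶜ p q) (mk≈ᶜ p′ q′) = mk≈ᶜ (+ᴿ-cong p p′) (+ᴿ-cong q q′)

*ᶜ-cong : ∀ {z z′ w w′} → z ≈ᶜ z′ → w ≈ᶜ w′ → z *ᶜ w ≈ᶜ z′ *ᶜ w′
*ᶜ-cong (mk≈ᶜ p q) (mk≈ᶜ p′ q′) = mk≈ᶜ
  (+ᴿ-cong (*ᴿ-cong p p′) (-ᴿ-cong (*ᴿ-cong q q′)))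
  (+ᴿ-cong (*ᴿ-cong p q′) (*ᴿ-cong q p′))

*ᶜ-negʳ : ∀ z w → z *ᶜ (-ᶜ w) ≈ᶜ -ᶜ (z *ᶜ w)
*ᶜ-negʳ z w = pointwise⇒≈ᶜ λ n → let mkℚ[i] a b = approx z n ; mkℚ[i] c d = approx w n in
  cong₂ mkℚ[i]
    (solve 4 (λ a b c d → a :* (:- c) :- b :* (:- d) := :- (a :* c :- b :* d)) refl a b c d)
    (solve 4 (λ a b c d → a :* (:- d) :+ b :* (:- c) := :- (a :* d :+ b :* c)) refl a b c d)

approx-bounded : ∀ z → ∃[ B ] (0ℚ ≤ B) × (∀ n → ‖ approx z n ‖ ≤ B)
approx-bounded z = let X , _ , x≤X = bounded (Re z) ; Y , _ , y≤Y = bounded (Im z) in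
  X + Y , ≤-trans (0≤‖‖ (approx z 0)) (+-mono-≤ (x≤X 0) (y≤Y 0)) , λ n → +-mono-≤ (x≤X n) (y≤Y n)

-- The value at z = lim zₙ of a locally uniform limit of functions Sₙ is
-- lim Sₙ(zₙ), which is how the power series is evaluated here.
expApprox : ℂ → ℕ → ℚ[i]
expApprox z n = expSum n (approx z n)

expApprox-cauchy : ∀ z → Vanishing (λ m n → ‖ expApprox z m ⊖ expApprox z n ‖)
expApprox-cauchy z with approx-bounded z
... | B , 0≤B , z≤B = vanish-mono
  (λ m n → let zₘ = approx z m ; zₙ = approx z n in
     ≤-trans (‖⊖‖-triangle (expSum m zₘ) (expSum m zₙ) (expSum n zₙ))
       (+-mono-≤ (≤-trans (expSum-lipschitz (z≤B m) (z≤B n) m)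
                          (*-monoʳ-≤ (0≤‖‖ (zₘ ⊖ zₙ)) (proj₂ (proj₂ majorant-bounded) m)))
                 (‖expSum⊖expSum‖≤ (z≤B n) m n)))
  (vanish-+ (vanish-* (proj₁ majorant-bounded) {{proj₁ (proj₂ majorant-bounded)}}
               (vanish-+ (cauchy (Re z)) (cauchy (Im z))))
            majorant-cauchy)
  where open ExpBounds B 0≤B

-- exp z = Σₖ zᵏ / k!
exp : ℂ → ℂ
seq    (Re (exp z)) n = re (expApprox z n)
cauchy (Re (exp z))   = vanish-mono
  (λ m n → ∣re∣≤‖‖ (expApprox z m ⊖ expApprox z n)) (expApprox-cauchy z)
seq    (Im (exp z)) n = im (expApprox z n)
cauchy (Im (exp z))   = vanish-mono
  (λ m n → ∣im∣≤‖‖ (expApprox z m ⊖ expApprox z n)) (expApprox-cauchy z)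

exp-cong : ∀ {z w} → z ≈ᶜ w → exp z ≈ᶜ exp w
exp-cong {z} {w} z≈w with approx-bounded z | approx-bounded w
... | X , 0≤X , z≤X | Y , 0≤Y , w≤Y = mk≈ᶜ
  (vanishing⇒≈ᴿ V λ n → ≤-trans (∣re∣≤‖‖ (expApprox z n ⊖ expApprox w n)) (le n))
  (vanishing⇒≈ᴿ V λ n → ≤-trans (∣im∣≤‖‖ (expApprox z n ⊖ expApprox w n)) (le n))
  where
  open ExpBounds (X + Y) (0≤p+q 0≤X 0≤Y)
  L = proj₁ majorant-bounded
  V : Vanishing (λ m n → L * ‖ approx z n ⊖ approx w n ‖)
  V = vanish-* L {{proj₁ (proj₂ majorant-bounded)}}
        (vanish-+ (diff-vanishing (Re-≈ z≈w)) (diff-vanishing (Im-≈ z≈w)))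
  le : ∀ n → ‖ expApprox z n ⊖ expApprox w n ‖ ≤ L * ‖ approx z n ⊖ approx w n ‖
  le n = ≤-trans
    (expSum-lipschitz (≤-trans (z≤X n) (p≤p+q 0≤Y)) (≤-trans (w≤Y n) (p≤q+p 0≤X)) n)
    (*-monoʳ-≤ (0≤‖‖ (approx z n ⊖ approx w n)) (proj₂ (proj₂ majorant-bounded) n))

e^i_ : ℝ → ℂ
e^i θ = exp (fromℚ 0ℚ +i θ)

infix 9 e^i_

e^i-pointwise : ∀ {θ η} → (∀ n → seq θ n ≡ seq η n) → e^i θ ≈ᶜ e^i η
e^i-pointwise eq = pointwise⇒≈ᶜ λ n → cong (λ q → expSum n (mkℚ[i] 0ℚ q)) (eq n)

------------------------------------------------------------------------
-- Magnetic triangulations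

-- Subsets of products are given by relations; functions on them take the
-- membership proof as an irrelevant argument, so their values depend only on
-- the underlying tuple of vertices.

record Graph : Set₁ where
  field
    V             : Set
    countable     : V ↣ ℕ
    E             : V → V → Set
    E-sym         : ∀ {x y} → E x y → E y x
    E-irrefl      : ∀ {x} → ¬ E x x
    connected     : ∀ x y → Star E x y
    locallyFinite : ∀ x → ∃[ ys ] ∀ y → E x y ⇔ y ∈ ys

-- Stability under (and, below, alternation for) all permutations of the entries
-- is expressed through the two adjacent transpositions, which generate S₃.
record Faces (G : Graph) : Set₁ where
  open Graph G
  field
    F        : V → V → V → Set
    F-swap₁₂ : ∀ {x y z} → F x y z → F y x z
    F-swap₂₃ : ∀ {x y z} → F x y z → F x z y
    F⇒E      : ∀ {x y z} → F x y z → E x y × E y z × E z x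

record Potential (G : Graph) : Set where
  open Graph G
  field
    pot      : ∀ x y → .(E x y) → ℝ
    pot-skew : ∀ x y .(e : E x y) → pot x y e ≈ᴿ -ᴿ pot y x (E-sym e)

record MagneticTriangulation : Set₁ where
  field
    G : Graph
    α : Potential G
    𝓕 : Faces G

record SkewE (G : Graph) : Set where
  open Graph G
  field
    onE    : ∀ x y → .(E x y) → ℂ
    E-skew : ∀ x y .(e : E x y) → onE x y e ≈ᶜ -ᶜ onE y x (E-sym e)

record SkewF {G : Graph} (𝓕 : Faces G) : Set where
  open Graph G
  open Faces 𝓕
  field
    onF      : ∀ x y z → .(F x y z) → ℂ
    F-skew₁₂ : ∀ x y z .(t : F x y z) → onF y x z (F-swap₁₂ t) ≈ᶜ -ᶜ onF x y z t
    F-skew₂₃ : ∀ x y z .(t : F x y z) → onF x z y (F-swap₂₃ t) ≈ᶜ -ᶜ onF x y z t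

infix 4 _≈ꟳ_
_≈ꟳ_ : {G : Graph} {𝓕 : Faces G} → SkewF 𝓕 → SkewF 𝓕 → Set
_≈ꟳ_ {G} {𝓕} ψ ψ′ = ∀ x y z (t : F x y z) → SkewF.onF ψ x y z t ≈ᶜ SkewF.onF ψ′ x y z t
  where open Faces 𝓕

module _ {G : Graph} where
  open Graph G
  open Potential
  open SkewE
  open SkewF

  infixl 6 _+ᵖ_
  _+ᵖ_ : Potential G → Potential G → Potential G
  pot (α +ᵖ β) x y e = pot α x y e +ᴿ pot β x y e
  pot-skew (α +ᵖ β) x y e = ≈ᴿ-trans
    (+ᴿ-cong (pot-skew α x y e) (pot-skew β x y e))
    (pointwise⇒≈ᴿ λ n → sym (neg-distrib-+ (seq (pot α y x _) n) (seq (pot β y x _) n)))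

  d⁰ : (V → ℝ) → Potential G
  pot (d⁰ f) x y _ = f y -ᴿ f x
  pot-skew (d⁰ f) x y _ = pointwise⇒≈ᴿ λ n →
    solve 2 (λ p q → q :- p := :- (p :- q)) refl (seq (f x) n) (seq (f y) n)

  -- The gauge actions e^{if}.φ and e^{if}.ψ.
  gaugeE : (V → ℝ) → SkewE G → SkewE G
  onE (gaugeE f φ) x y e = e^i (fromℚ (+ 1 / 2) *ᴿ (f x +ᴿ f y)) *ᶜ onE φ x y e
  E-skew (gaugeE f φ) x y e = ≈ᶜ-trans
    (*ᶜ-cong (e^i-pointwise λ n → cong ((+ 1 / 2) *_) (+-comm (seq (f x) n) (seq (f y) n)))
             (E-skew φ x y e))
    (*ᶜ-negʳ _ _)

  gaugeF : {𝓕 : Faces G} → (V → ℝ) → SkewF 𝓕 → SkewF 𝓕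
  onF (gaugeF f ψ) x y z t = e^i (fromℚ (+ 1 / 3) *ᴿ (f x +ᴿ f y +ᴿ f z)) *ᶜ onF ψ x y z t
  F-skew₁₂ (gaugeF f ψ) x y z t = ≈ᶜ-trans
    (*ᶜ-cong (e^i-pointwise λ n → cong ((+ 1 / 3) *_)
                (cong (_+ seq (f z) n) (+-comm (seq (f y) n) (seq (f x) n))))
             (F-skew₁₂ ψ x y z t))
    (*ᶜ-negʳ _ _)
  F-skew₂₃ (gaugeF f ψ) x y z t = ≈ᶜ-trans
    (*ᶜ-cong (e^i-pointwise λ n → cong ((+ 1 / 3) *_)
                (solve 3 (λ p q r → p :+ r :+ q := p :+ q :+ r) refl (seq (f x) n) (seq (f y) n) (seq (f z) n)))
             (F-skew₂₃ ψ x y z t))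
    (*ᶜ-negʳ _ _)

  -- The exterior magnetic derivative for the potential α.
  d¹ : {𝓕 : Faces G} → Potential G → SkewE G → SkewF 𝓕
  d¹ {𝓕} α φ = record
    { onF      = λ x y z t → value x y z (xy t) (yz t) (zx t)
    ; F-skew₁₂ = λ x y z t → ≈ᶜ-trans
        (+ᶜ-cong (+ᶜ-cong (flip y x (xy t) (swapped _ _))
                          (flip x z (zx t) (swapped _ _)))
                 (flip z y (yz t) (swapped _ _)))
        (rotate₂₃ _ _ _)
    ; F-skew₂₃ = λ x y z t → ≈ᶜ-trans
        (+ᶜ-cong (+ᶜ-cong (flip x z (zx t) (swapped _ _))
                          (flip z y (yz t) (swapped _ _)))
                 (flip y x (xy t) (swapped _ _)))
        (rotate₁₃ _ _ _)
    }
    where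
    open Faces 𝓕
    xy : ∀ {x y z} → F x y z → E x y
    xy t = proj₁ (F⇒E t)
    yz : ∀ {x y z} → F x y z → E y z
    yz t = proj₁ (proj₂ (F⇒E t))
    zx : ∀ {x y z} → F x y z → E z x
    zx t = proj₂ (proj₂ (F⇒E t))

    value : ∀ x y z → .(E x y) → .(E y z) → .(E z x) → ℂ
    value x y z exy eyz ezx =
         e^i (fromℚ (+ 1 / 6) *ᴿ (pot α x z (E-sym ezx) +ᴿ pot α y z eyz)) *ᶜ onE φ x y exy
      +ᶜ e^i (fromℚ (+ 1 / 6) *ᴿ (pot α y x (E-sym exy) +ᴿ pot α z x ezx)) *ᶜ onE φ y z eyz
      +ᶜ e^i (fromℚ (+ 1 / 6) *ᴿ (pot α z y (E-sym eyz) +ᴿ pot α x y exy)) *ᶜ onE φ z x ezx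

    swapped : ∀ a b → e^i (fromℚ (+ 1 / 6) *ᴿ (a +ᴿ b)) ≈ᶜ e^i (fromℚ (+ 1 / 6) *ᴿ (b +ᴿ a))
    swapped a b = e^i-pointwise λ n → cong ((+ 1 / 6) *_) (+-comm (seq a n) (seq b n))

    flip : ∀ {c c′} x y .(e : E y x) → c ≈ᶜ c′ →
      c *ᶜ onE φ x y (E-sym e) ≈ᶜ -ᶜ (c′ *ᶜ onE φ y x e)
    flip x y e c≈c′ = ≈ᶜ-trans (*ᶜ-cong c≈c′ (E-skew φ x y (E-sym e))) (*ᶜ-negʳ _ _)

    rotate₂₃ : ∀ u v w → (-ᶜ u) +ᶜ (-ᶜ w) +ᶜ (-ᶜ v) ≈ᶜ -ᶜ (u +ᶜ v +ᶜ w)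
    rotate₂₃ u v w = pointwise⇒≈ᶜ λ n → cong₂ mkℚ[i]
      (law (seq (Re u) n) (seq (Re v) n) (seq (Re w) n))
      (law (seq (Im u) n) (seq (Im v) n) (seq (Im w) n))
      where
      law : ∀ p q r → - p + - r + - q ≡ - (p + q + r)
      law = solve 3 (λ p q r → :- p :+ :- r :+ :- q := :- (p :+ q :+ r)) refl

    rotate₁₃ : ∀ u v w → (-ᶜ w) +ᶜ (-ᶜ v) +ᶜ (-ᶜ u) ≈ᶜ -ᶜ (u +ᶜ v +ᶜ w)
    rotate₁₃ u v w = pointwise⇒≈ᶜ λ n → cong₂ mkℚ[i]
      (law (seq (Re u) n) (seq (Re v) n) (seq (Re w) n))
      (law (seq (Im u) n) (seq (Im v) n) (seq (Im w) n))
      where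
      law : ∀ p q r → - r + - q + - p ≡ - (p + q + r)
      law = solve 3 (λ p q r → :- r :+ :- q :+ :- p := :- (p :+ q :+ r)) refl

{-# OPTIONS --safe #-}
module Submission where

-- On the summand of an edge xy opposite to z, the phases of the two sides agree because
--   (2 f(z) - f(x) - f(y)) / 6 + (f(x) + f(y)) / 2 = (f(x) + f(y) + f(z)) / 3,
-- so everything rests on exp z · exp w = exp (z + w). With Eₙ the partial sums of the series,
-- Eₙ(w + v) is the Cauchy product Σ_{j<n} wʲ/j! · Eₙ₋ⱼ(v): the terms of the Cauchy product of
-- the two series satisfy the recurrence (k+1) cₖ₊₁ = (w+v) cₖ by the Leibniz rule. Hence
-- Eₙ(w) Eₙ(v) - Eₙ(w + v) is dominated by the same expression for the majorant m of the
-- series, which is at most mₙ² - m_⌊n/2⌋ m_⌈n/2⌉ and tends to 0.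

open import Defs

open import Algebra.Bundles using (CommutativeRing; CommutativeSemiring)
import Algebra.Properties.Semiring.Mult as SemiringMult
import Algebra.Solver.Ring.NaturalCoefficients.Default as SemiringSolver
open import Algebra.Structures.Biased using (isCommutativeSemiringˡ)
open import Data.Integer.Base using (+_)
open import Data.Nat.Base as ℕ using (ℕ; zero; suc; ⌊_/2⌋; ⌈_/2⌉)
import Data.Nat.Properties as ℕ
open import Data.Product.Base using (_,_; proj₁; proj₂)
open import Function.Base using (_∘_)
open import Relation.Binary.PropositionalEquality
  using (_≡_; refl; sym; trans; cong; cong₂; isEquivalence; module ≡-Reasoning)

-- Cauchy products

module CauchyProduct {c ℓ} (R : CommutativeSemiring c ℓ) where
  open CommutativeSemiring R
    renaming (_+_ to _⊹_; _*_ to _∙_; refl to ≈-refl; sym to ≈-sym; trans to ≈-trans)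
  open SemiringMult semiring using (_×_)
  open SemiringSolver R using (solve; _:=_; _:+_; _:*_; con)
  open import Relation.Binary.Reasoning.Setoid setoid

  Sequence : Set c
  Sequence = ℕ → Carrier

  psum : Sequence → Sequence
  psum a zero    = 0#
  psum a (suc n) = a 0 ⊹ psum (a ∘ suc) n

  -- The n-th coefficient Σ_{i+j=n} aᵢ bⱼ of a product of power series. Only the left factor is
  -- shifted, so inductions run over all `a` with `b` fixed and no index is ever subtracted.
  conv : Sequence → Sequence → Sequence
  conv a b zero    = a 0 ∙ b 0
  conv a b (suc n) = a 0 ∙ b (suc n) ⊹ conv (a ∘ suc) b n

  -- `psum` peels from the front, in step with `conv`, whereas `expSum` and `majorant` append at the
  -- end; this reconciles the two.
  psum-suc : ∀ a n → psum a (suc n) ≈ psum a n ⊹ a n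
  psum-suc a zero    = +-comm (a 0) 0#
  psum-suc a (suc n) = ≈-trans (+-congˡ (psum-suc (a ∘ suc) n))
    (≈-sym (+-assoc (a 0) (psum (a ∘ suc) n) (a (suc n))))

  conv-cong : ∀ {a a′ b b′} → (∀ k → a k ≈ a′ k) → (∀ k → b k ≈ b′ k) →
    ∀ n → conv a b n ≈ conv a′ b′ n
  conv-cong p q zero    = *-cong (p 0) (q 0)
  conv-cong p q (suc n) = +-cong (*-cong (p 0) (q (suc n))) (conv-cong (p ∘ suc) q n)

  conv-+ˡ : ∀ a a′ b n → conv (λ k → a k ⊹ a′ k) b n ≈ conv a b n ⊹ conv a′ b n
  conv-+ˡ a a′ b zero    = distribʳ (b 0) (a 0) (a′ 0)
  conv-+ˡ a a′ b (suc n) = ≈-trans (+-congˡ (conv-+ˡ (a ∘ suc) (a′ ∘ suc) b n))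
    (solve 5 (λ x y z u v → (x :+ y) :* z :+ (u :+ v) := (x :* z :+ u) :+ (y :* z :+ v)) ≈-refl
      (a 0) (a′ 0) (b (suc n)) (conv (a ∘ suc) b n) (conv (a′ ∘ suc) b n))

  conv-+ʳ : ∀ a b b′ n → conv a (λ k → b k ⊹ b′ k) n ≈ conv a b n ⊹ conv a b′ n
  conv-+ʳ a b b′ zero    = distribˡ (a 0) (b 0) (b′ 0)
  conv-+ʳ a b b′ (suc n) = ≈-trans (+-congˡ (conv-+ʳ (a ∘ suc) b b′ n))
    (solve 5 (λ x y z u v → x :* (y :+ z) :+ (u :+ v) := (x :* y :+ u) :+ (x :* z :+ v)) ≈-refl
      (a 0) (b (suc n)) (b′ (suc n)) (conv (a ∘ suc) b n) (conv (a ∘ suc) b′ n))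

  conv-*ˡ : ∀ w a b n → conv (λ k → w ∙ a k) b n ≈ w ∙ conv a b n
  conv-*ˡ w a b zero    = *-assoc w (a 0) (b 0)
  conv-*ˡ w a b (suc n) = ≈-trans (+-congˡ (conv-*ˡ w (a ∘ suc) b n))
    (solve 4 (λ w x y u → (w :* x) :* y :+ w :* u := w :* (x :* y :+ u)) ≈-refl
      w (a 0) (b (suc n)) (conv (a ∘ suc) b n))

  conv-*ʳ : ∀ w a b n → conv a (λ k → w ∙ b k) n ≈ w ∙ conv a b n
  conv-*ʳ w a b zero    = solve 3 (λ w x y → x :* (w :* y) := w :* (x :* y)) ≈-refl w (a 0) (b 0)
  conv-*ʳ w a b (suc n) = ≈-trans (+-congˡ (conv-*ʳ w (a ∘ suc) b n))
    (solve 4 (λ w x y u → x :* (w :* y) :+ w :* u := w :* (x :* y :+ u)) ≈-refl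
      w (a 0) (b (suc n)) (conv (a ∘ suc) b n))

  -- A series `b` without constant term is t times the series of `b ∘ suc`, and a factor t lowers
  -- the index of the coefficient by one.
  conv-suc : ∀ a b → b 0 ≈ 0# → ∀ n → conv a b (suc n) ≈ conv a (b ∘ suc) n
  conv-suc a b b₀≈0 zero    = begin
    a 0 ∙ b 1 ⊹ a 1 ∙ b 0   ≈⟨ +-congˡ (*-congˡ b₀≈0) ⟩
    a 0 ∙ b 1 ⊹ a 1 ∙ 0#    ≈⟨ +-congˡ (zeroʳ (a 1)) ⟩
    a 0 ∙ b 1 ⊹ 0#          ≈⟨ +-identityʳ (a 0 ∙ b 1) ⟩
    a 0 ∙ b 1               ∎
  conv-suc a b b₀≈0 (suc n) = +-congˡ (conv-suc (a ∘ suc) b b₀≈0 n)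

  -- The coefficients of the derivative of the power series Σₖ aₖ tᵏ.
  deriv : Sequence → Sequence
  deriv a k = (suc k × 1#) ∙ a (suc k)

  -- Leibniz rule, by writing a = a₀ + t a⁺. Of the n + 2 copies of the coefficient `p` of a⁺b, n +
  -- 1 form a derivative and go to the induction hypothesis; the spare one is the a⁺ in a′ = a⁺ + t
  -- (a⁺)′.
  deriv-conv : ∀ a b n → deriv (conv a b) n ≈ conv (deriv a) b n ⊹ conv a (deriv b) n
  -- `con 1 :+ con 0` is the unfolded factor `1 × 1#`.
  deriv-conv a b zero = solve 4 (λ x y x′ y′ →
    (con 1 :+ con 0) :* (x :* y′ :+ x′ :* y) :=
    ((con 1 :+ con 0) :* x′) :* y :+ x :* ((con 1 :+ con 0) :* y′)) ≈-refl
    (a 0) (b 0) (a 1) (b 1)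
  deriv-conv a b (suc n) = begin
    (1# ⊹ ν) ∙ (x ∙ y ⊹ p)                         ≈⟨ solve 4 (λ ν x y p →
                                                        (con 1 :+ ν) :* (x :* y :+ p) :=
                                                        x :* ((con 1 :+ ν) :* y) :+ (p :+ ν :* p))
                                                        ≈-refl ν x y p ⟩
    x ∙ ((1# ⊹ ν) ∙ y) ⊹ (p ⊹ ν ∙ p)               ≈⟨ +-congˡ (+-congˡ (deriv-conv a⁺ b n)) ⟩
    x ∙ ((1# ⊹ ν) ∙ y) ⊹ ((x′ ∙ y′ ⊹ r) ⊹ (s ⊹ t)) ≈⟨ solve 6 (λ e x′ y′ r s t →
                                                        e :+ ((x′ :* y′ :+ r) :+ (s :+ t)) :=
                                                        (((con 1 :+ con 0) :* x′) :* y′ :+ (s :+ r)) :+ (e :+ t))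
                                                        ≈-refl (x ∙ ((1# ⊹ ν) ∙ y)) x′ y′ r s t ⟩
    (deriv a 0 ∙ y′ ⊹ (s ⊹ r)) ⊹ (x ∙ deriv b (suc n) ⊹ t)
                                                   ≈⟨ +-congʳ (+-congˡ (≈-sym shifted)) ⟩
    (deriv a 0 ∙ y′ ⊹ conv (deriv a ∘ suc) b n) ⊹ (x ∙ deriv b (suc n) ⊹ t) ∎
    where
    a⁺ = a ∘ suc
    ν  = suc n × 1#
    x  = a 0
    y  = b (suc (suc n))
    x′ = a 1
    y′ = b (suc n)
    p  = conv a⁺ b (suc n)
    r  = conv (a⁺ ∘ suc) b n
    s  = conv (deriv a⁺) b n
    t  = conv a⁺ (deriv b) n
    -- The identity a′ = a⁺ + t (a⁺)′, read off at the coefficients of positive index.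
    shifted : conv (deriv a ∘ suc) b n ≈ s ⊹ r
    shifted = ≈-trans
      (conv-cong (λ k → solve 2 (λ ν x → (con 1 :+ ν) :* x := ν :* x :+ x) ≈-refl
                          (suc k × 1#) (a (suc (suc k))))
                 (λ _ → ≈-refl) n)
      (conv-+ˡ (deriv a⁺) (a⁺ ∘ suc) b n)

  -- deriv a = w a characterises the multiples of the power series of exp (w t).
  deriv-conv-exponential : ∀ w v a b →
    (∀ k → deriv a k ≈ w ∙ a k) → (∀ k → deriv b k ≈ v ∙ b k) →
    ∀ n → deriv (conv a b) n ≈ (w ⊹ v) ∙ conv a b n
  deriv-conv-exponential w v a b p q n = begin
    deriv (conv a b) n                                ≈⟨ deriv-conv a b n ⟩
    conv (deriv a) b n ⊹ conv a (deriv b) n           ≈⟨ +-cong (conv-cong p (λ _ → ≈-refl) n)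
                                                                (conv-cong (λ _ → ≈-refl) q n) ⟩
    conv (λ k → w ∙ a k) b n ⊹ conv a (λ k → v ∙ b k) n ≈⟨ +-cong (conv-*ˡ w a b n) (conv-*ʳ v a b n) ⟩
    w ∙ conv a b n ⊹ v ∙ conv a b n                   ≈⟨ distribʳ (conv a b n) w v ⟨
    (w ⊹ v) ∙ conv a b n                              ∎

-- The exponential on the Gaussian rationals

open import Data.Rational.Base
open import Data.Rational.Properties
open import Data.Rational.Solver using (module +-*-Solver)
open +-*-Solver using (solve; _:=_; _:+_; _:*_; _:-_; :-_; con)

⊕-⊗-commutativeSemiring : CommutativeSemiring _ _
⊕-⊗-commutativeSemiring = record
  { Carrier = ℚ[i] ; _≈_ = _≡_ ; _+_ = _⊕_ ; _*_ = _⊗_ ; 0# = 0ᵍ ; 1# = 1ᵍ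
  ; isCommutativeSemiring = isCommutativeSemiringˡ record
    { +-isCommutativeMonoid = record
      { isMonoid = record
        { isSemigroup = record
          { isMagma = record { isEquivalence = isEquivalence ; ∙-cong = cong₂ _⊕_ }
          ; assoc = λ w v u → cong₂ mkℚ[i] (+-assoc (re w) (re v) (re u)) (+-assoc (im w) (im v) (im u)) }
        ; identity = (λ w → cong₂ mkℚ[i] (+-identityˡ (re w)) (+-identityˡ (im w)))
                   , (λ w → cong₂ mkℚ[i] (+-identityʳ (re w)) (+-identityʳ (im w))) }
      ; comm = λ w v → cong₂ mkℚ[i] (+-comm (re w) (re v)) (+-comm (im w) (im v)) }
    ; *-isCommutativeMonoid = record
      { isMonoid = record
        { isSemigroup = record
          { isMagma = record { isEquivalence = isEquivalence ; ∙-cong = cong₂ _⊗_ }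
          ; assoc = λ { (mkℚ[i] a b) (mkℚ[i] c d) (mkℚ[i] e f) → cong₂ mkℚ[i]
              (solve 6 (λ a b c d e f → (a :* c :- b :* d) :* e :- (a :* d :+ b :* c) :* f :=
                                        a :* (c :* e :- d :* f) :- b :* (c :* f :+ d :* e)) refl a b c d e f)
              (solve 6 (λ a b c d e f → (a :* c :- b :* d) :* f :+ (a :* d :+ b :* c) :* e :=
                                        a :* (c :* f :+ d :* e) :+ b :* (c :* e :- d :* f)) refl a b c d e f) } }
        ; identity = (λ w → cong₂ mkℚ[i]
                       (solve 2 (λ a b → con 1ℚ :* a :- con 0ℚ :* b := a) refl (re w) (im w))
                       (solve 2 (λ a b → con 1ℚ :* b :+ con 0ℚ :* a := b) refl (re w) (im w)))
                   , (λ w → cong₂ mkℚ[i]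
                       (solve 2 (λ a b → a :* con 1ℚ :- b :* con 0ℚ := a) refl (re w) (im w))
                       (solve 2 (λ a b → a :* con 0ℚ :+ b :* con 1ℚ := b) refl (re w) (im w))) }
      ; comm = λ { (mkℚ[i] a b) (mkℚ[i] c d) → cong₂ mkℚ[i]
          (solve 4 (λ a b c d → a :* c :- b :* d := c :* a :- d :* b) refl a b c d)
          (solve 4 (λ a b c d → a :* d :+ b :* c := c :* b :+ d :* a) refl a b c d) } }
    ; distribʳ = λ { (mkℚ[i] e f) (mkℚ[i] a b) (mkℚ[i] c d) → cong₂ mkℚ[i]
        (solve 6 (λ a b c d e f → (a :+ c) :* e :- (b :+ d) :* f :=
                                  (a :* e :- b :* f) :+ (c :* e :- d :* f)) refl a b c d e f)
        (solve 6 (λ a b c d e f → (a :+ c) :* f :+ (b :+ d) :* e :=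
                                  (a :* f :+ b :* e) :+ (c :* f :+ d :* e)) refl a b c d e f) }
    ; zeroˡ = λ w → cong₂ mkℚ[i]
        (solve 2 (λ a b → con 0ℚ :* a :- con 0ℚ :* b := con 0ℚ) refl (re w) (im w))
        (solve 2 (λ a b → con 0ℚ :* b :+ con 0ℚ :* a := con 0ℚ) refl (re w) (im w))
    } }

open CommutativeSemiring ⊕-⊗-commutativeSemiring using ()
  renaming (semiring to ⊕-⊗-semiring; *-assoc to ⊗-assoc; *-identityˡ to ⊗-identityˡ; distribˡ to ⊗-distribˡ-⊕)
open SemiringMult ⊕-⊗-semiring using (_×_)
open CauchyProduct ⊕-⊗-commutativeSemiring
-- The same calculus over ℚ, for the majorant series.
module ℚ-Cauchy = CauchyProduct (CommutativeRing.commutativeSemiring +-*-commutativeRing)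

×1ᵍ : ∀ n → n × 1ᵍ ≡ mkℚ[i] (ι n) 0ℚ
×1ᵍ zero    = refl
×1ᵍ (suc n) = trans (cong (1ᵍ ⊕_) (×1ᵍ n)) (cong (λ q → mkℚ[i] q 0ℚ) (sym (ι-+ 1 n)))

-- The differential equation determines only (n+1) aₙ₊₁; solving for the coefficient takes the
-- inverse of n + 1 in ℚ[i].
suc×1ᵍ-cancelˡ : ∀ n {w v} → (suc n × 1ᵍ) ⊗ w ≡ (suc n × 1ᵍ) ⊗ v → w ≡ v
suc×1ᵍ-cancelˡ n {w} {v} eq = trans (sym (divide w)) (trans (cong (ν⁻¹ ⊗_) eq) (divide v))
  where
  ν⁻¹ = mkℚ[i] (+ 1 / suc n) 0ℚ
  inverse : ν⁻¹ ⊗ (suc n × 1ᵍ) ≡ 1ᵍ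
  inverse = trans (cong (ν⁻¹ ⊗_) (×1ᵍ (suc n))) (cong₂ mkℚ[i]
    (trans (solve 2 (λ p q → p :* q :- con 0ℚ :* con 0ℚ := p :* q) refl (+ 1 / suc n) (ι (suc n)))
           (1/n*n≡1 (suc n)))
    (solve 2 (λ p q → p :* con 0ℚ :+ con 0ℚ :* q := con 0ℚ) refl (+ 1 / suc n) (ι (suc n))))
  divide : ∀ u → ν⁻¹ ⊗ ((suc n × 1ᵍ) ⊗ u) ≡ u
  divide u = trans (sym (⊗-assoc ν⁻¹ (suc n × 1ᵍ) u))
    (trans (cong (_⊗ u) inverse) (⊗-identityˡ u))

-- The exponential as a formal power series

expTerm : ℚ[i] → ℕ → ℚ[i]
expTerm w k = invFact k · w ⊗^ k

deriv-expTerm : ∀ w k → deriv (expTerm w) k ≡ w ⊗ expTerm w k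
deriv-expTerm w k = begin
  (suc k × 1ᵍ) ⊗ (c′ · (w ⊗ W))             ≡⟨ cong (_⊗ (c′ · (w ⊗ W))) (×1ᵍ (suc k)) ⟩
  mkℚ[i] s 0ℚ ⊗ (c′ · (w ⊗ W))              ≡⟨ cong₂ mkℚ[i]
      (solve 6 (λ s c a b x y → s :* (c :* (a :* x :- b :* y)) :- con 0ℚ :* (c :* (a :* y :+ b :* x)) :=
                                a :* (c :* s :* x) :- b :* (c :* s :* y)) refl s c′ (re w) (im w) (re W) (im W))
      (solve 6 (λ s c a b x y → s :* (c :* (a :* y :+ b :* x)) :+ con 0ℚ :* (c :* (a :* x :- b :* y)) :=
                                a :* (c :* s :* y) :+ b :* (c :* s :* x)) refl s c′ (re w) (im w) (re W) (im W)) ⟩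
  w ⊗ ((c′ * s) · W)                        ≡⟨ cong (λ q → w ⊗ (q · W)) (invFact-suc k) ⟩
  w ⊗ (invFact k · W)                       ∎
  where
  open ≡-Reasoning
  c′ = invFact (suc k)
  s  = ι (suc k)
  W  = w ⊗^ k

-- The recurrence (k+1) aₖ₊₁ = w aₖ together with a₀ = 1 fixes every coefficient.
expTerm-unique : ∀ {w} a → a 0 ≡ 1ᵍ → (∀ k → deriv a k ≡ w ⊗ a k) → ∀ k → a k ≡ expTerm w k
expTerm-unique     a a₀≡1 da zero    = a₀≡1
expTerm-unique {w} a a₀≡1 da (suc k) = suc×1ᵍ-cancelˡ k (trans (da k)
  (trans (cong (w ⊗_) (expTerm-unique a a₀≡1 da k)) (sym (deriv-expTerm w k))))

-- The binomial theorem divided by n!, obtained from uniqueness instead of binomial coefficients.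
conv-expTerm : ∀ w v n → conv (expTerm w) (expTerm v) n ≡ expTerm (w ⊕ v) n
conv-expTerm w v = expTerm-unique (conv (expTerm w) (expTerm v)) refl
  (deriv-conv-exponential w v (expTerm w) (expTerm v) (deriv-expTerm w) (deriv-expTerm v))

expSum≡psum : ∀ n w → expSum n w ≡ psum (expTerm w) n
expSum≡psum zero    w = refl
expSum≡psum (suc n) w = trans (cong (_⊕ expTerm w n) (expSum≡psum n w)) (sym (psum-suc (expTerm w) n))

-- Replacing every Eₖ(v) by Eₖ₊₁(v) adds exactly the part of degree n. The extra summand j = n of
-- `conv` vanishes because E₀ = 0, which is also what lets `conv-suc` shift the index.
expSum-⊕ : ∀ n w v → expSum n (w ⊕ v) ≡ conv (expTerm w) (λ k → expSum k v) n
expSum-⊕ zero    w v = refl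
expSum-⊕ (suc n) w v = begin
  expSum n (w ⊕ v) ⊕ expTerm (w ⊕ v) n                                ≡⟨ cong₂ _⊕_ (expSum-⊕ n w v) (sym (conv-expTerm w v n)) ⟩
  conv (expTerm w) (λ k → expSum k v) n ⊕ conv (expTerm w) (expTerm v) n ≡⟨ conv-+ʳ (expTerm w) (λ k → expSum k v) (expTerm v) n ⟨
  conv (expTerm w) (λ k → expSum (suc k) v) n                         ≡⟨ conv-suc (expTerm w) (λ k → expSum k v) refl n ⟨
  conv (expTerm w) (λ k → expSum k v) (suc n)                         ∎
  where open ≡-Reasoning

-- Domination of the truncation error by the majorant series

conv-nonneg : ∀ {a b} → (∀ k → 0ℚ ≤ a k) → (∀ k → 0ℚ ≤ b k) → ∀ n → 0ℚ ≤ ℚ-Cauchy.conv a b n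
conv-nonneg 0≤a 0≤b zero    = 0≤p*q (0≤a 0) (0≤b 0)
conv-nonneg 0≤a 0≤b (suc n) = 0≤p+q (0≤p*q (0≤a 0) (0≤b (suc n))) (conv-nonneg (0≤a ∘ suc) 0≤b n)

-- For j < m the convolution pairs aⱼ with b at index m + n - j, which is at least n, so
-- monotonicity applies; its remaining summands are nonnegative.
psum*≤conv : ∀ {a b} → (∀ k → 0ℚ ≤ a k) → (∀ k → 0ℚ ≤ b k) → (∀ {m n} → m ℕ.≤ n → b m ≤ b n) →
  ∀ m n → ℚ-Cauchy.psum a m * b n ≤ ℚ-Cauchy.conv a b (m ℕ.+ n)
psum*≤conv {a} {b} 0≤a 0≤b b-mono zero    n =
  ≤-trans (≤-reflexive (*-zeroˡ (b n))) (conv-nonneg 0≤a 0≤b n)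
psum*≤conv {a} {b} 0≤a 0≤b b-mono (suc m) n = begin
  (a 0 + P) * b n                 ≡⟨ *-distribʳ-+ (b n) (a 0) P ⟩
  a 0 * b n + P * b n             ≤⟨ +-mono-≤ (*-monoˡ-≤ (0≤a 0) (b-mono (ℕ.m≤n+m n (suc m))))
                                              (psum*≤conv (0≤a ∘ suc) 0≤b b-mono m n) ⟩
  a 0 * b (suc m ℕ.+ n) + ℚ-Cauchy.conv (a ∘ suc) b (m ℕ.+ n) ∎
  where
  open ≤-Reasoning
  P = ℚ-Cauchy.psum (a ∘ suc) m

module ExpProduct (B : ℚ) (0≤B : 0ℚ ≤ B) where
  open ExpBounds B 0≤B

  majorant≡psum : ∀ n → majorant n ≡ ℚ-Cauchy.psum term n
  majorant≡psum zero    = refl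
  majorant≡psum (suc n) = trans (cong (_+ term n) (majorant≡psum n)) (sym (ℚ-Cauchy.psum-suc term n))

  majorant-mono′ : ∀ {m n} → m ℕ.≤ n → majorant m ≤ majorant n
  majorant-mono′ m≤n = majorant-mono (ℕ.≤⇒≤′ m≤n)

  0≤majorant : ∀ n → 0ℚ ≤ majorant n
  0≤majorant n = majorant-mono′ {0} {n} ℕ.z≤n

  ‖expTerm‖≤ : ∀ {w} → ‖ w ‖ ≤ B → ∀ k → ‖ expTerm w k ‖ ≤ term k
  ‖expTerm‖≤ {w} w≤B k = ≤-trans (≤-reflexive (‖·‖≡ (invFact k) (w ⊗^ k) (0≤invFact k)))
    (*-monoˡ-≤ (0≤invFact k) (‖pow‖≤ w≤B k))

  -- psum a n ⊗ Eₘ - Σ_{j<n} aⱼ Eₙ₋ⱼ = Σ_{j<n} aⱼ (Eₘ - Eₙ₋ⱼ), which is dominated term by term.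
  psum⊗expSum-conv≤ : ∀ {v} → ‖ v ‖ ≤ B → ∀ {a t} → (∀ k → ‖ a k ‖ ≤ t k) → ∀ {m} n → n ℕ.≤ m →
    ‖ psum a n ⊗ expSum m v ⊖ conv a (λ k → expSum k v) n ‖ ≤
    ℚ-Cauchy.psum t n * majorant m - ℚ-Cauchy.conv t majorant n
  psum⊗expSum-conv≤ {v} v≤B {a} {t} a≤t {m} zero _ = ≤-reflexive (trans
    (cong ‖_‖ (cong₂ mkℚ[i]
      (solve 4 (λ x y p q → (con 0ℚ :* x :- con 0ℚ :* y) :- (p :* con 0ℚ :- q :* con 0ℚ) := con 0ℚ)
        refl (re E) (im E) (re (a 0)) (im (a 0)))
      (solve 4 (λ x y p q → (con 0ℚ :* y :+ con 0ℚ :* x) :- (p :* con 0ℚ :+ q :* con 0ℚ) := con 0ℚ)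
        refl (re E) (im E) (re (a 0)) (im (a 0)))))
    (solve 2 (λ x p → con 0ℚ := con 0ℚ :* x :- p :* con 0ℚ) refl (majorant m) (t 0)))
    where E = expSum m v
  psum⊗expSum-conv≤ {v} v≤B {a} {t} a≤t {m} (suc n) n<m = begin
    ‖ (x ⊕ P) ⊗ E ⊖ (x ⊗ E′ ⊕ C) ‖         ≡⟨ cong ‖_‖ (cong₂ mkℚ[i]
        (solve 10 (λ x y p q e f e′ f′ c d →
          ((x :+ p) :* e :- (y :+ q) :* f) :- ((x :* e′ :- y :* f′) :+ c) :=
          (x :* (e :- e′) :- y :* (f :- f′)) :+ ((p :* e :- q :* f) :- c)) refl
          (re x) (im x) (re P) (im P) (re E) (im E) (re E′) (im E′) (re C) (im C))
        (solve 10 (λ x y p q e f e′ f′ c d →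
          ((x :+ p) :* f :+ (y :+ q) :* e) :- ((x :* f′ :+ y :* e′) :+ d) :=
          (x :* (f :- f′) :+ y :* (e :- e′)) :+ ((p :* f :+ q :* e) :- d)) refl
          (re x) (im x) (re P) (im P) (re E) (im E) (re E′) (im E′) (re C) (im C))) ⟩
    ‖ x ⊗ (E ⊖ E′) ⊕ (P ⊗ E ⊖ C) ‖         ≤⟨ ‖⊕‖≤ (x ⊗ (E ⊖ E′)) (P ⊗ E ⊖ C) ⟩
    ‖ x ⊗ (E ⊖ E′) ‖ + ‖ P ⊗ E ⊖ C ‖       ≤⟨ +-mono-≤
        (≤-trans (‖⊗‖≤ x (E ⊖ E′))
          (*-mono-≤ (0≤‖‖ (E ⊖ E′)) (≤-trans (0≤‖‖ x) (a≤t 0)) (a≤t 0) (‖expSum-tail‖≤ v≤B (ℕ.≤⇒≤′ n<m))))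
        -- Here n drops while m stays, which is why the two are separate.
        (psum⊗expSum-conv≤ v≤B (a≤t ∘ suc) n (ℕ.<⇒≤ n<m)) ⟩
    t 0 * (majorant m - majorant (suc n)) + (P′ * majorant m - C′)
                                           ≡⟨ solve 5 (λ t e e′ p c →
                                                t :* (e :- e′) :+ (p :* e :- c) := (t :+ p) :* e :- (t :* e′ :+ c))
                                                refl (t 0) (majorant m) (majorant (suc n)) P′ C′ ⟩
    (t 0 + P′) * majorant m - (t 0 * majorant (suc n) + C′) ∎
    where
    open ≤-Reasoning
    x  = a 0
    P  = psum (a ∘ suc) n
    E  = expSum m v
    E′ = expSum (suc n) v
    C  = conv (a ∘ suc) (λ k → expSum k v) n
    P′ = ℚ-Cauchy.psum (t ∘ suc) n
    C′ = ℚ-Cauchy.conv (t ∘ suc) majorant n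

  -- The error consists of the products of terms with j, k < n and j + k ≥ n. For the majorant, the
  -- rectangle j < ⌊n/2⌋, k < ⌈n/2⌉ lies inside the triangle j + k < n, so subtracting it alone
  -- leaves an upper bound.
  expSum-⊕-error : ∀ {w v} → ‖ w ‖ ≤ B → ‖ v ‖ ≤ B → ∀ n →
    ‖ expSum n w ⊗ expSum n v ⊖ expSum n (w ⊕ v) ‖ ≤
    majorant n * majorant n - majorant ⌊ n /2⌋ * majorant ⌈ n /2⌉
  expSum-⊕-error {w} {v} w≤B v≤B n = begin
    ‖ expSum n w ⊗ expSum n v ⊖ expSum n (w ⊕ v) ‖
      ≡⟨ cong₂ (λ p q → ‖ p ⊗ expSum n v ⊖ q ‖) (expSum≡psum n w) (expSum-⊕ n w v) ⟩
    ‖ psum (expTerm w) n ⊗ expSum n v ⊖ conv (expTerm w) (λ k → expSum k v) n ‖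
      ≤⟨ psum⊗expSum-conv≤ v≤B (‖expTerm‖≤ w≤B) n ℕ.≤-refl ⟩
    ℚ-Cauchy.psum term n * majorant n - ℚ-Cauchy.conv term majorant n
      ≤⟨ +-mono-≤ (≤-reflexive (cong (_* majorant n) (sym (majorant≡psum n)))) (neg-antimono-≤ square) ⟩
    majorant n * majorant n - majorant ⌊ n /2⌋ * majorant ⌈ n /2⌉ ∎
    where
    open ≤-Reasoning
    square : majorant ⌊ n /2⌋ * majorant ⌈ n /2⌉ ≤ ℚ-Cauchy.conv term majorant n
    square = begin
      majorant ⌊ n /2⌋ * majorant ⌈ n /2⌉               ≡⟨ cong (_* majorant ⌈ n /2⌉) (majorant≡psum ⌊ n /2⌋) ⟩
      ℚ-Cauchy.psum term ⌊ n /2⌋ * majorant ⌈ n /2⌉     ≤⟨ psum*≤conv 0≤term 0≤majorant majorant-mono′ ⌊ n /2⌋ ⌈ n /2⌉ ⟩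
      ℚ-Cauchy.conv term majorant (⌊ n /2⌋ ℕ.+ ⌈ n /2⌉) ≡⟨ cong (ℚ-Cauchy.conv term majorant) (ℕ.⌊n/2⌋+⌈n/2⌉≡n n) ⟩
      ℚ-Cauchy.conv term majorant n                     ∎

  -- The majorant is bounded by `L` and Cauchy, so a difference of products reduces to the distances
  -- between its values at n and at the two halves of n.
  error-vanishing : Vanishing (λ _ n →
    majorant n * majorant n - majorant ⌊ n /2⌋ * majorant ⌈ n /2⌉)
  error-vanishing = vanish-mono
    (λ _ n → ≤-trans (p≤∣p∣ _) (∣pq-rs∣≤′ (majorant n) (majorant n) (majorant ⌊ n /2⌋) (majorant ⌈ n /2⌉)
      (∣majorant∣≤L n) (∣majorant∣≤L ⌈ n /2⌉)))
    (vanish-+ (vanish-* L {{L>0}} (halved ⌈_/2⌉ ℕ.⌈n/2⌉-mono n≤⌈n+n/2⌉))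
              (vanish-* L {{L>0}} (halved ⌊_/2⌋ ℕ.⌊n/2⌋-mono (λ n → ℕ.≤-reflexive (ℕ.n≡⌊n+n/2⌋ n)))))
    where
    L   = proj₁ majorant-bounded
    L>0 = proj₁ (proj₂ majorant-bounded)
    ∣majorant∣≤L : ∀ n → ∣ majorant n ∣ ≤ L
    ∣majorant∣≤L n = ≤-trans (≤-reflexive (0≤p⇒∣p∣≡p (0≤majorant n))) (proj₂ (proj₂ majorant-bounded) n)
    n≤⌈n+n/2⌉ : ∀ n → n ℕ.≤ ⌈ n ℕ.+ n /2⌉
    n≤⌈n+n/2⌉ n = ℕ.≤-trans (ℕ.≤-reflexive (ℕ.n≡⌊n+n/2⌋ n)) (ℕ.⌊n/2⌋≤⌈n/2⌉ (n ℕ.+ n))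
    halved : ∀ h → (∀ {m n} → m ℕ.≤ n → h m ℕ.≤ h n) → (∀ n → n ℕ.≤ h (n ℕ.+ n)) →
      Vanishing (λ _ n → ∣ majorant n - majorant (h n) ∣)
    halved h mono above ε 0<ε = let N , small = majorant-cauchy ε 0<ε in
      -- For n ≥ N + N, monotonicity gives h n ≥ h (N + N) ≥ N.
      N ℕ.+ N , λ _ n _ l → small n (h n) (ℕ.m+n≤o⇒n≤o N l) (ℕ.≤-trans (above N) (mono l))

-- The functional equation of the exponential

exp-+ : ∀ z w → exp z *ᶜ exp w ≈ᶜ exp (z +ᶜ w)
exp-+ z w with approx-bounded z | approx-bounded w
... | X , 0≤X , z≤X | Y , 0≤Y , w≤Y = mk≈ᶜ
  (vanishing⇒≈ᴿ error-vanishing λ n → ≤-trans (∣re∣≤‖‖ (difference n)) (le n))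
  (vanishing⇒≈ᴿ error-vanishing λ n → ≤-trans (∣im∣≤‖‖ (difference n)) (le n))
  where
  -- `exp` is the diagonal limit of Eₙ(zₙ), so the bound must be uniform over one ball; radius X + Y
  -- contains all approximations of both z and w.
  open ExpProduct (X + Y) (0≤p+q 0≤X 0≤Y)
  difference : ℕ → ℚ[i]
  difference n = expApprox z n ⊗ expApprox w n ⊖ expApprox (z +ᶜ w) n
  le = λ n → expSum-⊕-error (≤-trans (z≤X n) (p≤p+q 0≤Y)) (≤-trans (w≤Y n) (p≤q+p 0≤X)) n

-- Gauge invariance

e^i-+ : ∀ θ η → e^i θ *ᶜ e^i η ≈ᶜ e^i (θ +ᴿ η)
-- `refl` suffices since the real parts 0 + 0 evaluate to 0.
e^i-+ θ η = ≈ᶜ-trans (exp-+ _ _) (exp-cong (pointwise⇒≈ᶜ λ n → refl))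

*ᶜ-assoc : ∀ z w u → z *ᶜ w *ᶜ u ≈ᶜ z *ᶜ (w *ᶜ u)
*ᶜ-assoc z w u = pointwise⇒≈ᶜ λ n → ⊗-assoc (approx z n) (approx w n) (approx u n)

*ᶜ-distribˡ-+ᶜ : ∀ z w u → z *ᶜ (w +ᶜ u) ≈ᶜ z *ᶜ w +ᶜ z *ᶜ u
*ᶜ-distribˡ-+ᶜ z w u = pointwise⇒≈ᶜ λ n → ⊗-distribˡ-⊕ (approx z n) (approx w n) (approx u n)

-- Two phases act only through the sum of their angles, so comparing them becomes a rational
-- identity at each index.
e^i-e^i : ∀ θ η ζ ξ u → (∀ n → seq θ n + seq η n ≡ seq ζ n + seq ξ n) →
  e^i θ *ᶜ (e^i η *ᶜ u) ≈ᶜ e^i ζ *ᶜ (e^i ξ *ᶜ u)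
e^i-e^i θ η ζ ξ u eq = ≈ᶜ-trans (≈ᶜ-sym (*ᶜ-assoc (e^i θ) (e^i η) u)) (≈ᶜ-trans
  (*ᶜ-cong (≈ᶜ-trans (e^i-+ θ η) (≈ᶜ-trans (e^i-pointwise eq) (≈ᶜ-sym (e^i-+ ζ ξ)))) ≈ᶜ-refl)
  (*ᶜ-assoc (e^i ζ) (e^i ξ) u))

-- The phase of one summand of d¹: p and q are the values of the potential at the two edges
-- from the end points a, b of an edge to the opposite vertex c.
gauge-phase : ∀ {p q a b c s} u → (∀ n → seq a n + seq b n + seq c n ≡ seq s n) →
  e^i (fromℚ (+ 1 / 6) *ᴿ ((p +ᴿ (c -ᴿ a)) +ᴿ (q +ᴿ (c -ᴿ b)))) *ᶜ (e^i (fromℚ (+ 1 / 2) *ᴿ (a +ᴿ b)) *ᶜ u) ≈ᶜ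
  e^i (fromℚ (+ 1 / 3) *ᴿ s) *ᶜ (e^i (fromℚ (+ 1 / 6) *ᴿ (p +ᴿ q)) *ᶜ u)
gauge-phase {p} {q} {a} {b} {c} u sum = e^i-e^i _ _ _ _ u λ n → trans
  (solve 5 (λ p q a b c →
      con (+ 1 / 6) :* ((p :+ (c :- a)) :+ (q :+ (c :- b))) :+ con (+ 1 / 2) :* (a :+ b) :=
      con (+ 1 / 3) :* (a :+ b :+ c) :+ con (+ 1 / 6) :* (p :+ q))
    refl (seq p n) (seq q n) (seq a n) (seq b n) (seq c n))
  (cong (λ r → (+ 1 / 3) * r + (+ 1 / 6) * (seq p n + seq q n)) (sum n))

mainTheorem6 : (T : MagneticTriangulation) →
    let open MagneticTriangulation T in
    (f : Graph.V G → ℝ) (φ : SkewE G) →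
    d¹ {𝓕 = 𝓕} (α +ᵖ d⁰ f) (gaugeE f φ) ≈ꟳ gaugeF {𝓕 = 𝓕} f (d¹ α φ)
mainTheorem6 T f φ x y z t = ≈ᶜ-trans
  -- The triples (a, b, c) are the rotations (x, y, z), (y, z, x), (z, x, y); the sums of f are
  -- reordered to the one in `g`.
  (+ᶜ-cong (+ᶜ-cong
    (gauge-phase _ λ n → refl)
    (gauge-phase _ λ n → solve 3 (λ a b c → b :+ c :+ a := a :+ b :+ c) refl
                           (seq (f x) n) (seq (f y) n) (seq (f z) n)))
    (gauge-phase _ λ n → solve 3 (λ a b c → c :+ a :+ b := a :+ b :+ c) refl
                           (seq (f x) n) (seq (f y) n) (seq (f z) n)))
  (≈ᶜ-sym (≈ᶜ-trans (*ᶜ-distribˡ-+ᶜ g _ _) (+ᶜ-cong (*ᶜ-distribˡ-+ᶜ g _ _) ≈ᶜ-refl)))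
  where g = e^i (fromℚ (+ 1 / 3) *ᴿ (f x +ᴿ f y +ᴿ f z))
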